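{- Let $k\ge1$, let $T=N^yE^x$, let $B$ be an arbitrary lattice path with steps $N=(0,1)$, $E=(1,0)$ from the origin to $(x,y)$, and let $\lambda=\lambda(T,B)$. There is a bijection $\Psi$ between the $k$-tuples $\mathbf P\in\mathcal P^k(T,B)$ with $h_i(\mathbf P)=h_i$ for $0\le i\le k$ and $u_s(\mathbf P)=u_s$ for $1\le s<y$, and the $k$-flagged semistandard Young tableaux of shape $\lambda$ and weight $$(\lambda_1-h_0,\lambda_1-h_1,\dots,\lambda_1-h_k,\,u_1,u_2,\dots,u_{y-1}).$$
   Context: $\mathcal P(T,B)$ is the set of lattice paths with steps $N,E$ from the origin to $(x,y)$ lying weakly above $B$ and weakly below $T$. $\mathcal P^k(T,B)$ is the set of $k$-tuples $\mathbf P=(P_1,\dots,P_k)$ of paths in $\mathcal P(T,B)$ with $P_i$ weakly above $P_{i+1}$. With $P_0=T$, $P_{k+1}=B$, $h_i(\mathbf P)$ is the number of east steps on which $P_i$ and $P_{i+1}$ coincide; for $1\le s\le y-1$, $u_s(\mathbf P)$ is the number of unit east steps of the lattice at $y$-coordinate $y-s$ lying strictly between $T$ and $B$ and not used by any of $P_1,\dots,P_k$. The region between $T$ and $B$ is the Young diagram (English notation) of a partition $\lambda(T,B)$ whose parts $x\ge\lambda_1\ge\dots\ge\lambda_y\ge0$ are the row lengths from top to bottom. A semistandard Young tableau of shape $\lambda$ is a filling with positive integers, weakly increasing along rows and strictly increasing down columns; it is $k$-flagged if every entry in row $r$ is at most $k+r$. Its weight is $(\mu_1,\mu_2,\dots)$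 with $\mu_i$ the number of entries equal to $i$.
   Formalization: The weight entries λ_1−h_i are replaced by λ_1−(h_i−c), where c is the number of east steps common to T and B (c=x−λ_1, zero if B ends with N); as stated the claim fails when B ends with an east step, e.g. k=1, B=ENE, P=B. -}

module Defs where

open import Data.Nat using (ℕ; zero; suc; _+_; _∸_; _≤_; _<_; _≡ᵇ_; _<ᵇ_)
open import Data.Bool using (Bool; true; false; _∧_; not; if_then_else_)
open import Data.List using (List; []; _∷_; _++_; length; map; upTo; concat; take; zipWith; head)
open import Data.List.Relation.Unary.All using (All)
open import Data.List.Relation.Unary.Linked using (Linked)
open import Data.List.Relation.Binary.Pointwise using (Pointwise)
open import Data.Maybe using (fromMaybe)
open import Data.Vec using (Vec; toList)
open import Data.Integer using (ℤ; +_; _-_)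
open import Data.Product using (Σ; _×_)
open import Data.Unit using (⊤)
open import Relation.Binary.PropositionalEquality using (_≡_)

data Step : Set where
  N E : Step

Path : Set
Path = List Step

countStep : Step → Path → ℕ
countStep s [] = 0
countStep N (N ∷ p) = suc (countStep N p)
countStep N (E ∷ p) = countStep N p
countStep E (N ∷ p) = countStep E p
countStep E (E ∷ p) = suc (countStep E p)

PathTo : ℕ → ℕ → Path → Set
PathTo x y P = (countStep E P ≡ x) × (countStep N P ≡ y)

rep : ℕ → Step → Path
rep zero s = []
rep (suc n) s = s ∷ rep n s

topPath : ℕ → ℕ → Path
topPath x y = rep y N ++ rep x E

-- eastHeights P = [e₀ , e₁ , …] where the p-th east step of P (counted
-- from 0) is the unit segment from (p , eₚ) to (p+1 , eₚ).
eastHeightsFrom : ℕ → Path → List ℕ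
eastHeightsFrom h [] = []
eastHeightsFrom h (N ∷ P) = eastHeightsFrom (suc h) P
eastHeightsFrom h (E ∷ P) = h ∷ eastHeightsFrom h P

eastHeights : Path → List ℕ
eastHeights = eastHeightsFrom 0

-- height of the p-th east step (default 0 out of range; only used in range)
nth : List ℕ → ℕ → ℕ
nth [] p = 0
nth (a ∷ as) zero = a
nth (a ∷ as) (suc p) = nth as p

-- P lies weakly above Q (both paths from the origin to the same endpoint):
-- in every column p, the east step of P is at least as high as that of Q.
WeaklyAbove : Path → Path → Set
WeaklyAbove P Q = Pointwise (λ a b → b ≤ a) (eastHeights P) (eastHeights Q)

InP : ℕ → ℕ → Path → Path → Path → Set
InP x y T B P = PathTo x y P × WeaklyAbove P B × WeaklyAbove T P

InPk : ℕ → ℕ → (k : ℕ) → Path → Path → Vec Path k → Set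
InPk x y k T B Ps = All (InP x y T B) (toList Ps) × Linked WeaklyAbove (toList Ps)

anyB : List Bool → Bool
anyB [] = false
anyB (b ∷ bs) = if b then true else anyB bs

boolCount : List Bool → ℕ
boolCount [] = 0
boolCount (true ∷ bs) = suc (boolCount bs)
boolCount (false ∷ bs) = boolCount bs

coincide : Path → Path → ℕ
coincide P Q = boolCount (zipWith _≡ᵇ_ (eastHeights P) (eastHeights Q))

consecCoincide : List Path → List ℕ
consecCoincide [] = []
consecCoincide (P ∷ []) = []
consecCoincide (P ∷ Q ∷ Ps) = coincide P Q ∷ consecCoincide (Q ∷ Ps)

hVec : {k : ℕ} → Path → Path → Vec Path k → List ℕ
hVec T B Ps = consecCoincide (T ∷ toList Ps ++ B ∷ [])

unusedAt : ℕ → Path → Path → List Path → ℕ → ℕ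
unusedAt x T B Ps j = boolCount (map free (upTo x))
  where
  used : ℕ → Bool
  used p = anyB (map (λ P → nth (eastHeights P) p ≡ᵇ j) Ps)
  free : ℕ → Bool
  free p = (nth (eastHeights B) p <ᵇ j) ∧ (j <ᵇ nth (eastHeights T) p) ∧ not (used p)

uVec : {k : ℕ} → ℕ → ℕ → Path → Path → Vec Path k → List ℕ
uVec x y T B Ps = map (λ s → unusedAt x T B (toList Ps) (y ∸ s)) (map suc (upTo (y ∸ 1)))

-- The partition λ(T,B): row r (r = 1 … y, top to bottom) is the strip
-- between y-coordinates y-r and y-r+1; its length is the number of
-- columns p whose unit cell in that strip lies between B and T,
-- i.e. e_B(p) ≤ y-r and y-r+1 ≤ e_T(p).

rowLength : ℕ → ℕ → Path → Path → ℕ → ℕ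
rowLength x y T B r = boolCount (map inRow (upTo x))
  where
  q = y ∸ r
  inRow : ℕ → Bool
  inRow p = (nth (eastHeights B) p <ᵇ suc q) ∧ (q <ᵇ nth (eastHeights T) p)

shapeTB : ℕ → ℕ → Path → Path → List ℕ
shapeTB x y T B = map (λ i → rowLength x y T B (suc i)) (upTo y)

firstPart : List ℕ → ℕ
firstPart λs = fromMaybe 0 (head λs)

-- Young tableaux (English notation): list of rows, top row first.

Tableau : Set
Tableau = List (List ℕ)

ColStrict : List ℕ → List ℕ → Set
ColStrict r₁ r₂ = Pointwise _<_ (take (length r₂) r₁) r₂

IsSSYT : List ℕ → Tableau → Set
IsSSYT λs t =
  Pointwise (λ row len → length row ≡ len) t λs ×
  All (All (1 ≤_)) t ×
  All (Linked _≤_) t ×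
  Linked ColStrict t

FlaggedFrom : ℕ → ℕ → Tableau → Set
FlaggedFrom k r [] = ⊤
FlaggedFrom k r (row ∷ t) = All (_≤ k + r) row × FlaggedFrom k (suc r) t

Flagged : ℕ → Tableau → Set
Flagged k t = FlaggedFrom k 1 t

countEntry : ℕ → Tableau → ℕ
countEntry i t = boolCount (map (i ≡ᵇ_) (concat t))

-- the weight (μ₁ , μ₂ , …) equals the finite sequence w padded with zeros
HasWeight : List ℤ → Tableau → Set
HasWeight w t =
  map (λ i → + countEntry (suc i) t) (upTo (length w)) ≡ w ×
  All (All (_≤ length w)) t

PathTuples : (k x y : ℕ) → Path → Vec ℕ (suc k) → Vec ℕ (y ∸ 1) → Set
PathTuples k x y B h u =
  Σ (Vec Path k) λ Ps →
    InPk x y k (topPath x y) B Ps ×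
    hVec (topPath x y) B Ps ≡ toList h ×
    uVec x y (topPath x y) B Ps ≡ toList u

-- number of east steps common to T and B (all forced); it is 0 exactly
-- when B ends with a north step
forced : ℕ → ℕ → Path → ℕ
forced x y B = coincide (topPath x y) B

-- (λ₁ - h₀ , … , λ₁ - h_k , u₁ , … , u_{y-1}) as integers, where the
-- hᵢ are corrected by the forced common east steps of T and B
targetWeight : (k x y : ℕ) → Path → Vec ℕ (suc k) → Vec ℕ (y ∸ 1) → List ℤ
targetWeight k x y B h u =
  map (λ hi → + λ₁ - (+ hi - + forced x y B)) (toList h) ++ map +_ (toList u)
  where
  λ₁ = firstPart (shapeTB x y (topPath x y) B)

FlaggedTableaux : (k x y : ℕ) → Path → Vec ℕ (suc k) → Vec ℕ (y ∸ 1) → Set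
FlaggedTableaux k x y B h u =
  Σ Tableau λ t →
    IsSSYT (shapeTB x y (topPath x y) B) t ×
    Flagged k t ×
    HasWeight (targetWeight k x y B h u) t

{-# OPTIONS --safe #-}
-- Let α j t be the number of columns in which P_j runs below height t.  These numbers are
-- last passage times of a matrix of non-negative integers (the jumps): its j-th row sums to
-- x − h_j, and its column at height y − s sums to λ_s − u_s when the last passage times with
-- j = k + 1 are the parts of λ.  Robinson–Schensted–Knuth, in the shape of Fomin's growth
-- diagrams, turns the matrix into partitions G j t with first part α j t, each unit square of
-- which satisfies a local rule solvable towards either of two opposite corners.  A tableau
-- occupies the other two edges: the partition G j y is the shape of its entries ≤ j, and the
-- parts of G (k + 1) (y − s) count the entries ≤ k + 1 + s in the rows s + 1, s + 2, …; the
-- first of these rows is full because of the flag, so its count is again a part of λ.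
module Submission where

open import Defs
open import Data.Bool using (Bool; true; false; _∧_; not)
open import Data.Bool.Properties using (∧-zeroʳ; ∧-identityʳ)
open import Data.Empty using (⊥; ⊥-elim)
open import Data.Integer as ℤ using (ℤ)
import Data.Integer.Properties as ℤ
import Data.Integer.Tactic.RingSolver as ℤ
open import Data.List using (List; []; _∷_; _++_; length; map; upTo; applyUpTo; zipWith; concat; take)
open import Data.List.Properties
open import Data.List.Relation.Binary.Pointwise using (Pointwise; []; _∷_; Pointwise-length)
import Data.List.Relation.Binary.Pointwise.Properties as Pointwise
open import Data.List.Relation.Unary.All as All using (All; []; _∷_)
open import Data.List.Relation.Unary.Linked as Linked using (Linked; []; [-]; _∷_)
open import Data.Nat
open import Data.Nat.Properties hiding (≡-irrelevant)
open import Data.Nat.Tactic.RingSolver using (solve-∀)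
open import Data.Product using (Σ; ∃; _×_; _,_; proj₁; proj₂)
open import Data.Sum using (inj₁; inj₂)
open import Data.Unit using (tt)
open import Data.Vec using (Vec; []; _∷_; toList)
open import Data.Vec.Properties using (length-toList; toList-injective; cast-is-id)
open import Function using (_∘_; case_of_)
open import Function.Bundles using (_⇔_; mk⇔; module Equivalence; _⤖_; mk⤖)
open import Function.Consequences.Propositional using (strictlySurjective⇒surjective)
open import Relation.Binary.Definitions using (tri<; tri≈; tri>)
open import Relation.Binary.PropositionalEquality
open import Relation.Binary.PropositionalEquality.WithK using (≡-irrelevant)
open import Relation.Nullary using (Irrelevant)
open import Algebra.Properties.CommutativeSemigroup +-commutativeSemigroup using (interchange; xy∙z≈xz∙y)
open Equivalence using (to; from)

-- Counting below a threshold

-- In a square with corners `l`, `m`, `n`, `k`, interlacing confines both `l i` and `k (suc i)` to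
-- the interval from `m (suc i) ⊔ n (suc i)` to `m i ⊓ n i`. The local rule is the reflection of
-- this interval, hence reversible. Outside it stands `k 0`: towards the north-east it may be any
-- number from `m 0 ⊔ n 0` on, and the excess is the jump; towards the south-west the rule consults
-- only the later parts of `k`. A flagged tableau fits the right edge because of a diagonal slicing:
-- each step drops one row and raises the bound on the entries by one, so that column strictness and
-- monotonicity in the bound exchange the roles which they have on the top edge. Entry counts come
-- from sizes: the size grows by a row sum of jumps along the top edge and by a column sum along the
-- right edge. The statistics `h` and `u` do not enter the construction: a tuple and a tableau are
-- related when they share a diagram, this relation is a function in both directions, and weights
-- are compared afterwards.

∑ : ℕ → (ℕ → ℕ) → ℕ
∑ zero f = 0
∑ (suc n) f = ∑ n f + f n

∑-cong : ∀ n {f g : ℕ → ℕ} → (∀ p → p < n → f p ≡ g p) → ∑ n f ≡ ∑ n g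
∑-cong zero eq = refl
∑-cong (suc n) eq = cong₂ _+_ (∑-cong n λ p p<n → eq p (m<n⇒m<1+n p<n)) (eq n ≤-refl)

∑-distrib-+ : ∀ n (f g : ℕ → ℕ) → ∑ n (λ p → f p + g p) ≡ ∑ n f + ∑ n g
∑-distrib-+ zero f g = refl
∑-distrib-+ (suc n) f g =
  trans (cong (_+ (f n + g n)) (∑-distrib-+ n f g)) (interchange (∑ n f) (∑ n g) (f n) (g n))

∑-zero : ∀ n {f : ℕ → ℕ} → (∀ p → p < n → f p ≡ 0) → ∑ n f ≡ 0
∑-zero zero eq = refl
∑-zero (suc n) eq = cong₂ _+_ (∑-zero n λ p p<n → eq p (m<n⇒m<1+n p<n)) (eq n ≤-refl)

∑-one : ∀ n {f : ℕ → ℕ} → (∀ p → p < n → f p ≡ 1) → ∑ n f ≡ n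
∑-one zero eq = refl
∑-one (suc n) eq =
  trans (cong₂ _+_ (∑-one n λ p p<n → eq p (m<n⇒m<1+n p<n)) (eq n ≤-refl)) (+-comm n 1)

∑-mono : ∀ n {f g : ℕ → ℕ} → (∀ p → p < n → f p ≤ g p) → ∑ n f ≤ ∑ n g
∑-mono zero le = z≤n
∑-mono (suc n) le = +-mono-≤ (∑-mono n λ p p<n → le p (m<n⇒m<1+n p<n)) (le n ≤-refl)

∑-swap : ∀ m n (f : ℕ → ℕ → ℕ) → ∑ m (λ i → ∑ n (f i)) ≡ ∑ n (λ j → ∑ m (λ i → f i j))
∑-swap zero n f = sym (∑-zero n λ _ _ → refl)
∑-swap (suc m) n f =
  trans (cong (_+ ∑ n (f m)) (∑-swap m n f)) (sym (∑-distrib-+ n _ (f m)))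

∑-split : ∀ s d (f : ℕ → ℕ) → ∑ (s + d) f ≡ ∑ s f + ∑ d (λ i → f (s + i))
∑-split s zero f rewrite +-identityʳ s = sym (+-identityʳ _)
∑-split s (suc d) f rewrite +-suc s d =
  trans (cong (_+ f (s + d)) (∑-split s d f)) (+-assoc (∑ s f) _ _)

∑-head : ∀ n (f : ℕ → ℕ) → ∑ (suc n) f ≡ f 0 + ∑ n (f ∘ suc)
∑-head n f = ∑-split 1 n f

∑-shift : ∀ n (f : ℕ → ℕ) → ∑ n (f ∘ suc) + f 0 ≡ ∑ n f + f n
∑-shift n f = trans (+-comm _ (f 0)) (sym (∑-head n f))

∑-telescope : ∀ n (f g : ℕ → ℕ) → (∀ p → p < n → f (suc p) ≡ f p + g p) → f n ≡ f 0 + ∑ n g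
∑-telescope zero f g step = sym (+-identityʳ _)
∑-telescope (suc n) f g step =
  trans (step n ≤-refl)
    (trans (cong (_+ g n) (∑-telescope n f g λ p p<n → step p (m<n⇒m<1+n p<n)))
      (+-assoc (f 0) _ _))

bit : Bool → ℕ
bit false = 0
bit true = 1

lt : ℕ → ℕ → ℕ
lt a t = bit (a <ᵇ t)

lt-yes : ∀ {a t} → a < t → lt a t ≡ 1
lt-yes {zero} {suc t} _ = refl
lt-yes {suc a} {suc t} (s≤s p) = lt-yes p

lt-no : ∀ {a t} → t ≤ a → lt a t ≡ 0
lt-no {a} {zero} _ = refl
lt-no {suc a} {suc t} (s≤s p) = lt-no p

lt-mono : ∀ {a t b u} → (a < t → b < u) → lt a t ≤ lt b u
lt-mono {a} {t} imp with <-≤-connex a t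
... | inj₁ a<t = ≤-reflexive (trans (lt-yes a<t) (sym (lt-yes (imp a<t))))
... | inj₂ t≤a = subst (_≤ _) (sym (lt-no t≤a)) z≤n

lt-cong : ∀ {a t b u} → (a < t ⇔ b < u) → lt a t ≡ lt b u
lt-cong e = ≤-antisym (lt-mono (to e)) (lt-mono (from e))

∑-lt : ∀ n c → c ≤ n → ∑ n (λ p → lt p c) ≡ c
∑-lt n c c≤n = begin
  ∑ n (λ p → lt p c)
    ≡⟨ cong (λ m → ∑ m λ p → lt p c) (sym (m+[n∸m]≡n c≤n)) ⟩
  ∑ (c + (n ∸ c)) (λ p → lt p c)
    ≡⟨ ∑-split c (n ∸ c) _ ⟩
  ∑ c (λ p → lt p c) + ∑ (n ∸ c) (λ p → lt (c + p) c)
    ≡⟨ cong₂ _+_ (∑-one c λ _ → lt-yes) (∑-zero (n ∸ c) λ p _ → lt-no (m≤m+n c p)) ⟩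
  c + 0 ≡⟨ +-identityʳ c ⟩
  c ∎ where open ≡-Reasoning

cnt : ℕ → (ℕ → ℕ) → ℕ → ℕ
cnt x a t = ∑ x λ p → lt (a p) t

Sorted : ℕ → (ℕ → ℕ) → Set
Sorted x a = ∀ p q → p ≤ q → q < x → a p ≤ a q

sorted-from-steps : ∀ {x a} → (∀ p → suc p < x → a p ≤ a (suc p)) → Sorted x a
sorted-from-steps {x} {a} step p q p≤q = go q (≤⇒≤′ p≤q)
  where
  go : ∀ q → p ≤′ q → q < x → a p ≤ a q
  go .p (≤′-reflexive refl) _ = ≤-refl
  go (suc q) (≤′-step p≤q) q< = ≤-trans (go q p≤q (<⇒≤ q<)) (step q q<)

cnt-≤ : ∀ x a t → cnt x a t ≤ x
cnt-≤ x a t = subst (cnt x a t ≤_) (∑-one x λ _ _ → refl) (∑-mono x λ p _ → bit≤1 (a p <ᵇ t))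
  where
  bit≤1 : ∀ b → bit b ≤ 1
  bit≤1 false = z≤n
  bit≤1 true = ≤-refl

cnt-mono : ∀ x {a b t u} → (∀ p → p < x → a p < t → b p < u) → cnt x a t ≤ cnt x b u
cnt-mono x imp = ∑-mono x λ p p<x → lt-mono (imp p p<x)

cnt-monoʳ : ∀ x a {t u} → t ≤ u → cnt x a t ≤ cnt x a u
cnt-monoʳ x a t≤u = cnt-mono x λ p _ a<t → <-≤-trans a<t t≤u

cnt-all : ∀ x a t → (∀ p → p < x → a p < t) → cnt x a t ≡ x
cnt-all x a t all = ∑-one x λ p p<x → lt-yes (all p p<x)

cnt-none : ∀ x a t → (∀ p → p < x → t ≤ a p) → cnt x a t ≡ 0
cnt-none x a t none = ∑-zero x λ p p<x → lt-no (none p p<x)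

-- Sortedness makes the columns below the threshold an initial segment, so its length decides
-- membership. This Galois connection is what lets counts stand in for heights throughout.
cnt-spec : ∀ {x a} → Sorted x a → ∀ {p} t → p < x → (p < cnt x a t ⇔ a p < t)
cnt-spec {suc x} {a} sorted {p} t p<1+x with <-≤-connex (a x) t
... | inj₁ ax<t =
  mk⇔ (λ _ → below p p<1+x) (λ _ → subst (p <_) (sym (cnt-all (suc x) a t below)) p<1+x)
  where
  below : ∀ q → q < suc x → a q < t
  below q q<1+x = ≤-<-trans (sorted q x (≤-pred q<1+x) ≤-refl) ax<t
... | inj₂ t≤ax rewrite lt-no t≤ax | +-identityʳ (cnt x a t) with m≤n⇒m<n∨m≡n (≤-pred p<1+x)
...   | inj₁ p<x = cnt-spec (λ q r q≤r r<x → sorted q r q≤r (m<n⇒m<1+n r<x)) t p<x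
...   | inj₂ refl = mk⇔ (λ p<c → ⊥-elim (<⇒≱ p<c (cnt-≤ p a t))) (λ a<t → ⊥-elim (<⇒≱ a<t t≤ax))

cnt-unique : ∀ {x a} t c → c ≤ x → (∀ p → p < x → (a p < t ⇔ p < c)) → cnt x a t ≡ c
cnt-unique {x} t c c≤x spec = trans (∑-cong x λ p p<x → lt-cong (spec p p<x)) (∑-lt x c c≤x)

-- Two initial segments are nested, so their union has the larger size.
cnt-⊔ : ∀ {x a b} → Sorted x a → Sorted x b → ∀ t u →
  cnt x a t ⊔ cnt x b u ≡ ∑ x (λ p → lt (a p) t ⊔ lt (b p) u)
cnt-⊔ {x} {a} {b} sa sb t u with ≤-total (cnt x a t) (cnt x b u)
... | inj₁ le = trans (m≤n⇒m⊔n≡n le) (∑-cong x λ p p<x → sym (m≤n⇒m⊔n≡n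
        (lt-mono λ a<t → to (cnt-spec sb u p<x) (<-≤-trans (from (cnt-spec sa t p<x) a<t) le))))
... | inj₂ le = trans (m≥n⇒m⊔n≡m le) (∑-cong x λ p p<x → sym (m≥n⇒m⊔n≡m
        (lt-mono λ b<u → to (cnt-spec sa t p<x) (<-≤-trans (from (cnt-spec sb u p<x) b<u) le))))

-- The sorted sequence whose counting function is F is itself a counting function of F.
conj : ℕ → (ℕ → ℕ) → ℕ → ℕ
conj M F p = cnt M F (suc p)

conj-spec : ∀ {M F} → Sorted M F → ∀ {m} p → m < M → (conj M F p < suc m ⇔ p < F m)
conj-spec {M} {F} sF {m} p m<M =
  mk⇔ (λ c<1+m → ≰⇒> λ Fm≤p → <⇒≱ (from (cnt-spec sF (suc p) m<M) (s≤s Fm≤p)) (≤-pred c<1+m))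
      (λ p<Fm → s≤s (≮⇒≥ λ m<c → <⇒≱ p<Fm (≤-pred (to (cnt-spec sF (suc p) m<M) m<c))))

conj-sorted : ∀ M F x → Sorted x (conj M F)
conj-sorted M F x p q p≤q _ = cnt-monoʳ M F (s≤s p≤q)

cnt-conj : ∀ {M F} → Sorted M F → ∀ x {m} → m < M → F m ≤ x → cnt x (conj M F) (suc m) ≡ F m
cnt-conj sF x m<M Fm≤x = cnt-unique _ _ Fm≤x λ p _ → conj-spec sF p m<M

-- The threshold `t = b` alone refutes `a < b`. Hence counts at thresholds up to a common bound `Y`
-- compare, and determine, sorted sequences.
≤-by-threshold : ∀ {a b} Y → b ≤ Y → (∀ t → t ≤ Y → a < t → b < t) → b ≤ a
≤-by-threshold {a} {b} Y b≤Y imp = ≮⇒≥ λ a<b → <-irrefl refl (imp b b≤Y a<b)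

cnt-≤⇒≥ : ∀ {x a b} → Sorted x a → Sorted x b → ∀ Y → (∀ p → p < x → b p ≤ Y) →
  (∀ t → t ≤ Y → cnt x a t ≤ cnt x b t) → ∀ p → p < x → b p ≤ a p
cnt-≤⇒≥ sa sb Y b≤Y le p p<x = ≤-by-threshold Y (b≤Y p p<x) λ t t≤Y a<t →
  to (cnt-spec sb t p<x) (<-≤-trans (from (cnt-spec sa t p<x) a<t) (le t t≤Y))

cnt-injective : ∀ {x a b} → Sorted x a → Sorted x b → ∀ Y →
  (∀ p → p < x → a p ≤ Y) → (∀ p → p < x → b p ≤ Y) →
  (∀ t → t ≤ Y → cnt x a t ≡ cnt x b t) → ∀ p → p < x → a p ≡ b p
cnt-injective sa sb Y a≤Y b≤Y eq p p<x = ≤-antisym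
  (cnt-≤⇒≥ sb sa Y a≤Y (λ t t≤Y → ≤-reflexive (sym (eq t t≤Y))) p p<x)
  (cnt-≤⇒≥ sa sb Y b≤Y (λ t t≤Y → ≤-reflexive (eq t t≤Y)) p p<x)

-- Growth diagrams

infix 4 _≺_
-- For partitions: `g / f` is a horizontal strip. The relation forces both functions to be weakly
-- decreasing, so being a partition is never a separate condition.
_≺_ : (ℕ → ℕ) → (ℕ → ℕ) → Set
f ≺ g = ∀ i → f i ≤ g i × g (suc i) ≤ f i

-- The corners are `l` south-west, `k` north-east, `m` and `n` between them. The first part of `k`
-- is deliberately left open; it carries the matrix entry.
LocalRule : (l m n k : ℕ → ℕ) → Set
LocalRule l m n k = ∀ i → l i + k (suc i) ≡ (m i ⊓ n i) + (m (suc i) ⊔ n (suc i))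

-- A Bender-Knuth toggle: the reflection of the interval from `m (suc i) ⊔ n (suc i)` to
-- `m i ⊓ n i`, on which the truncated subtraction is exact.
toggle : (m n : ℕ → ℕ) → ℕ → ℕ → ℕ
toggle m n c i = ((m i ⊓ n i) + (m (suc i) ⊔ n (suc i))) ∸ c

-- `l≤⊓` and `⊔≤l` place `l i` in the interval that `toggle i` reflects, so `k (suc i)` lies in it
-- too. This is the interlacing with `k` in all parts but the first, where `k0` supplies the bound.
growCell : ∀ {l m n k} → l ≺ m → l ≺ n → m 0 ⊔ n 0 ≤ k 0 →
  (∀ i → k (suc i) ≡ toggle m n (l i) i) → m ≺ k × n ≺ k × LocalRule l m n k
growCell {l} {m} {n} {k} lm ln k0 rule =
  (λ i → ≤-trans (m≤m⊔n (m i) (n i)) (⊔≤k i) , ≤-trans (upper i) (m⊓n≤m _ _)) ,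
  (λ i → ≤-trans (m≤n⊔m (m i) (n i)) (⊔≤k i) , ≤-trans (upper i) (m⊓n≤n _ _)) ,
  λ i → trans (cong (l i +_) (rule i)) (m+[n∸m]≡n (≤-trans (l≤⊓ i) (m≤m+n _ _)))
  where
  l≤⊓ : ∀ i → l i ≤ m i ⊓ n i
  l≤⊓ i = ⊓-glb (proj₁ (lm i)) (proj₁ (ln i))
  ⊔≤l : ∀ i → m (suc i) ⊔ n (suc i) ≤ l i
  ⊔≤l i = ⊔-lub (proj₂ (lm i)) (proj₂ (ln i))
  ⊔≤k : ∀ i → m i ⊔ n i ≤ k i
  ⊔≤k zero = k0
  ⊔≤k (suc i) = subst (_ ≤_) (sym (rule i))
    (m+n≤o⇒m≤o∸n _ (≤-trans (+-monoʳ-≤ _ (l≤⊓ i)) (≤-reflexive (+-comm _ (m i ⊓ n i)))))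
  upper : ∀ i → k (suc i) ≤ m i ⊓ n i
  upper i = subst (_≤ m i ⊓ n i) (sym (rule i))
    (≤-trans (∸-monoʳ-≤ _ (⊔≤l i)) (≤-reflexive (m+n∸n≡m (m i ⊓ n i) (m (suc i) ⊔ n (suc i)))))

shrinkCell : ∀ {l m n k} → m ≺ k → n ≺ k →
  (∀ i → l i ≡ toggle m n (k (suc i)) i) → l ≺ m × l ≺ n × LocalRule l m n k
shrinkCell {l} {m} {n} {k} mk nk rule =
  (λ i → ≤-trans (lower i) (m⊓n≤m _ _) , ≤-trans (m≤m⊔n _ _) (⊔≤l i)) ,
  (λ i → ≤-trans (lower i) (m⊓n≤n _ _) , ≤-trans (m≤n⊔m _ _) (⊔≤l i)) ,
  λ i → trans (cong (_+ k (suc i)) (rule i)) (m∸n+n≡m (≤-trans (k≤⊓ i) (m≤m+n _ _)))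
  where
  k≤⊓ : ∀ i → k (suc i) ≤ m i ⊓ n i
  k≤⊓ i = ⊓-glb (proj₂ (mk i)) (proj₂ (nk i))
  ⊔≤k : ∀ i → m i ⊔ n i ≤ k i
  ⊔≤k i = ⊔-lub (proj₁ (mk i)) (proj₁ (nk i))
  ⊔≤l : ∀ i → m (suc i) ⊔ n (suc i) ≤ l i
  ⊔≤l i = subst (_ ≤_) (sym (rule i))
    (m+n≤o⇒m≤o∸n _ (≤-trans (+-monoʳ-≤ _ (k≤⊓ i)) (≤-reflexive (+-comm _ (m i ⊓ n i)))))
  lower : ∀ i → l i ≤ m i ⊓ n i
  lower i = subst (_≤ m i ⊓ n i) (sym (rule i))
    (≤-trans (∸-monoʳ-≤ _ (⊔≤k (suc i))) (≤-reflexive (m+n∸n≡m (m i ⊓ n i) (m (suc i) ⊔ n (suc i)))))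

record Growth (n y : ℕ) (G : ℕ → ℕ → ℕ → ℕ) : Set where
  field
    hor : ∀ j t → j < n → t ≤ y → G j t ≺ G (suc j) t
    ver : ∀ j t → j ≤ n → t < y → G j t ≺ G j (suc t)
    cell : ∀ j t → j < n → t < y → LocalRule (G j t) (G (suc j) t) (G j (suc t)) (G (suc j) (suc t))
    left : ∀ t → t ≤ y → ∀ i → G 0 t i ≡ 0
    bottom : ∀ j → j ≤ n → ∀ i → G j 0 i ≡ 0

  -- Each vertical step adds a horizontal strip, hence at most one new part, and the bottom
  -- partition is empty. Sums of parts may therefore stop at `y`.
  vanish : ∀ j t i → j ≤ n → t ≤ y → t ≤ i → G j t i ≡ 0
  vanish j zero i j≤n _ _ = bottom j j≤n i
  vanish j (suc t) (suc i) j≤n t<y (s≤s t≤i) = n≤0⇒n≡0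
    (≤-trans (proj₂ (ver j t j≤n t<y i)) (≤-reflexive (vanish j t i j≤n (<⇒≤ t<y) t≤i)))

-- Only first parts are prescribed. The rule carries part `i` of the south-west corner to part
-- `suc i` of the north-east one, starting from empty partitions on the axes.
forward : (ℕ → ℕ → ℕ) → ℕ → ℕ → ℕ → ℕ
forward α j t zero = α j t
forward α zero t (suc i) = 0
forward α (suc j) zero (suc i) = 0
forward α (suc j) (suc t) (suc i) = toggle (forward α (suc j) t) (forward α j (suc t)) (forward α j t i) i

module _ {n y : ℕ} {α : ℕ → ℕ → ℕ}
  (α-left : ∀ t → t ≤ y → α 0 t ≡ 0)
  (α-bottom : ∀ j → j ≤ n → α j 0 ≡ 0)
  (α-hor : ∀ j t → j < n → t ≤ y → α j t ≤ α (suc j) t)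
  (α-ver : ∀ j t → j ≤ n → t < y → α j t ≤ α j (suc t))
  where

  private
    G = forward α

    left₀ : ∀ t → t ≤ y → ∀ i → G 0 t i ≡ 0
    left₀ t t≤y zero = α-left t t≤y
    left₀ t t≤y (suc i) = refl

    bottom₀ : ∀ j → j ≤ n → ∀ i → G j 0 i ≡ 0
    bottom₀ j j≤n zero = α-bottom j j≤n
    bottom₀ zero j≤n (suc i) = refl
    bottom₀ (suc j) j≤n (suc i) = refl

    zeros : ∀ {f g : ℕ → ℕ} → (∀ i → f i ≡ 0) → (∀ i → g i ≡ 0) → f ≺ g
    zeros f0 g0 i = ≤-reflexive (trans (f0 i) (sym (g0 i))) ,
                    ≤-reflexive (trans (g0 (suc i)) (sym (f0 i)))

    hor₀ : ∀ j t → j < n → t ≤ y → G j t ≺ G (suc j) t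
    ver₀ : ∀ j t → j ≤ n → t < y → G j t ≺ G j (suc t)
    cell₀ : ∀ j t → j < n → t < y →
      G (suc j) t ≺ G (suc j) (suc t) × G j (suc t) ≺ G (suc j) (suc t) ×
      LocalRule (G j t) (G (suc j) t) (G j (suc t)) (G (suc j) (suc t))

    hor₀ j zero j<n t≤y = zeros (bottom₀ j (<⇒≤ j<n)) (bottom₀ (suc j) j<n)
    hor₀ j (suc t) j<n t<y = proj₁ (proj₂ (cell₀ j t j<n t<y))
    ver₀ zero t j≤n t<y = zeros (left₀ t (<⇒≤ t<y)) (left₀ (suc t) t<y)
    ver₀ (suc j) t j<n t<y = proj₁ (cell₀ j t j<n t<y)
    cell₀ j t j<n t<y = growCell (hor₀ j t j<n (<⇒≤ t<y)) (ver₀ j t (<⇒≤ j<n) t<y)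
      (⊔-lub (α-ver (suc j) t j<n t<y) (α-hor j (suc t) j<n t<y)) (λ i → refl)

  forward-growth : Growth n y (forward α)
  forward-growth = record
    { hor = hor₀ ; ver = ver₀
    ; cell = λ j t j<n t<y → proj₂ (proj₂ (cell₀ j t j<n t<y))
    ; left = left₀ ; bottom = bottom₀ }

-- The cell rule run downwards from the north-east corner; both indices count the distance to it.
backward : (U R : ℕ → ℕ → ℕ) → ℕ → ℕ → ℕ → ℕ
backward U R zero b i = R b i
backward U R (suc a) zero i = U (suc a) i
backward U R (suc a) (suc b) i =
  toggle (backward U R a (suc b)) (backward U R (suc a) b) (backward U R a b (suc i)) i

module _ {n y : ℕ} {U R : ℕ → ℕ → ℕ}
  (corner : ∀ i → U 0 i ≡ R 0 i)
  (U-chain : ∀ a → a < n → U (suc a) ≺ U a)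
  (R-chain : ∀ b → b < y → R (suc b) ≺ R b)
  (U-end : ∀ i → U n i ≡ 0)
  (R-end : ∀ i → R y i ≡ 0)
  where

  private
    H = backward U R

    H-top : ∀ a i → H a 0 i ≡ U a i
    H-top zero i = sym (corner i)
    H-top (suc a) i = refl

    hor₁ : ∀ a b → a < n → b ≤ y → H (suc a) b ≺ H a b
    ver₁ : ∀ a b → a ≤ n → b < y → H a (suc b) ≺ H a b
    cell₁ : ∀ a b → a < n → b < y →
      H (suc a) (suc b) ≺ H a (suc b) × H (suc a) (suc b) ≺ H (suc a) b ×
      LocalRule (H (suc a) (suc b)) (H a (suc b)) (H (suc a) b) (H a b)

    hor₁ a zero a<n b≤y i = subst (U (suc a) i ≤_) (sym (H-top a i)) (proj₁ (U-chain a a<n i)) ,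
                            subst (_≤ U (suc a) i) (sym (H-top a (suc i))) (proj₂ (U-chain a a<n i))
    hor₁ a (suc b) a<n b<y = proj₁ (cell₁ a b a<n b<y)
    ver₁ zero b a≤n b<y = R-chain b b<y
    ver₁ (suc a) b a<n b<y = proj₁ (proj₂ (cell₁ a b a<n b<y))
    cell₁ a b a<n b<y =
      shrinkCell (ver₁ a b (<⇒≤ a<n) b<y) (hor₁ a b a<n (<⇒≤ b<y)) (λ i → refl)

    left₁ : ∀ b → b ≤ y → ∀ i → H n b i ≡ 0
    left₁ zero _ i = trans (H-top n i) (U-end i)
    left₁ (suc b) b<y i = n≤0⇒n≡0
      (≤-trans (proj₁ (ver₁ n b ≤-refl b<y i)) (≤-reflexive (left₁ b (<⇒≤ b<y) i)))

    bottom₁ : ∀ a → a ≤ n → ∀ i → H a y i ≡ 0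
    bottom₁ zero _ i = R-end i
    bottom₁ (suc a) a<n i = n≤0⇒n≡0
      (≤-trans (proj₁ (hor₁ a y a<n ≤-refl i)) (≤-reflexive (bottom₁ a (<⇒≤ a<n) i)))

    ∸-step : ∀ {m j} → j < m → m ∸ j ≡ suc (m ∸ suc j)
    ∸-step j<m = +-∸-assoc 1 j<m

    below : ∀ {m j} → j < m → m ∸ suc j < m
    below {m} {j} j<m = subst (_≤ m) (∸-step j<m) (m∸n≤m m j)

    Ĝ : ℕ → ℕ → ℕ → ℕ
    Ĝ j t = H (n ∸ j) (y ∸ t)

    hor₂ : ∀ j t → j < n → t ≤ y → Ĝ j t ≺ Ĝ (suc j) t
    hor₂ j t j<n t≤y rewrite ∸-step j<n = hor₁ _ _ (below j<n) (m∸n≤m y t)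

    ver₂ : ∀ j t → j ≤ n → t < y → Ĝ j t ≺ Ĝ j (suc t)
    ver₂ j t j≤n t<y rewrite ∸-step t<y = ver₁ _ _ (m∸n≤m n j) (below t<y)

    cell₂ : ∀ j t → j < n → t < y → LocalRule (Ĝ j t) (Ĝ (suc j) t) (Ĝ j (suc t)) (Ĝ (suc j) (suc t))
    cell₂ j t j<n t<y rewrite ∸-step j<n | ∸-step t<y =
      proj₂ (proj₂ (cell₁ _ _ (below j<n) (below t<y)))

  backward-growth : Growth n y (λ j t → backward U R (n ∸ j) (y ∸ t))
  backward-growth = record
    { hor = hor₂ ; ver = ver₂ ; cell = cell₂
    ; left = λ t _ → left₁ _ (m∸n≤m y t) ; bottom = λ j _ → bottom₁ _ (m∸n≤m n j) }

module _ {n y : ℕ} {G G' : ℕ → ℕ → ℕ → ℕ} (gr : Growth n y G) (gr' : Growth n y G') where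
  private
    module L = Growth gr
    module L' = Growth gr'

  growth-unique : (∀ j t → j ≤ n → t ≤ y → G j t 0 ≡ G' j t 0) →
    ∀ j t i → j ≤ n → t ≤ y → G j t i ≡ G' j t i
  growth-unique eq j t zero j≤n t≤y = eq j t j≤n t≤y
  growth-unique eq zero t i j≤n t≤y = trans (L.left t t≤y i) (sym (L'.left t t≤y i))
  growth-unique eq j zero i j≤n t≤y = trans (L.bottom j j≤n i) (sym (L'.bottom j j≤n i))
  growth-unique eq (suc j) (suc t) (suc i) j<n t<y = +-cancelˡ-≡ (G j t i) _ _ (begin
    G j t i + G (suc j) (suc t) (suc i) ≡⟨ L.cell j t j<n t<y i ⟩
    (G (suc j) t i ⊓ G j (suc t) i) + (G (suc j) t (suc i) ⊔ G j (suc t) (suc i))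
      ≡⟨ cong₂ _+_ (cong₂ _⊓_ (rec (suc j) t i j<n (<⇒≤ t<y)) (rec j (suc t) i (<⇒≤ j<n) t<y))
                   (cong₂ _⊔_ (rec (suc j) t (suc i) j<n (<⇒≤ t<y))
                              (rec j (suc t) (suc i) (<⇒≤ j<n) t<y)) ⟩
    (G' (suc j) t i ⊓ G' j (suc t) i) + (G' (suc j) t (suc i) ⊔ G' j (suc t) (suc i))
      ≡⟨ L'.cell j t j<n t<y i ⟨
    G' j t i + G' (suc j) (suc t) (suc i)
      ≡⟨ cong (_+ G' (suc j) (suc t) (suc i)) (rec j t i (<⇒≤ j<n) (<⇒≤ t<y)) ⟨
    G j t i + G' (suc j) (suc t) (suc i) ∎)
    where
    open ≡-Reasoning
    rec = growth-unique eq

  private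
    -- `a` and `b` are the distances to the right and top edges; carrying them explicitly makes the
    -- induction away from the north-east corner structural.
    growth-uniqueᵇ′ : (∀ j → j ≤ n → ∀ i → G j y i ≡ G' j y i) →
      (∀ t → t ≤ y → ∀ i → G n t i ≡ G' n t i) →
      ∀ a b j t → a + j ≡ n → b + t ≡ y → ∀ i → G j t i ≡ G' j t i
    growth-uniqueᵇ′ top right zero b j t refl refl i = right t (m≤n+m t b) i
    growth-uniqueᵇ′ top right a zero j t refl refl i = top j (m≤n+m j a) i
    growth-uniqueᵇ′ top right (suc a) (suc b) j t ja tb i = +-cancelʳ-≡ (G (suc j) (suc t) (suc i)) _ _ (begin
      G j t i + G (suc j) (suc t) (suc i) ≡⟨ L.cell j t j<n t<y i ⟩
      (G (suc j) t i ⊓ G j (suc t) i) + (G (suc j) t (suc i) ⊔ G j (suc t) (suc i))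
        ≡⟨ cong₂ _+_ (cong₂ _⊓_ (r₁ i) (r₂ i)) (cong₂ _⊔_ (r₁ (suc i)) (r₂ (suc i))) ⟩
      (G' (suc j) t i ⊓ G' j (suc t) i) + (G' (suc j) t (suc i) ⊔ G' j (suc t) (suc i))
        ≡⟨ L'.cell j t j<n t<y i ⟨
      G' j t i + G' (suc j) (suc t) (suc i)
        ≡⟨ cong (G' j t i +_) (growth-uniqueᵇ′ top right a b (suc j) (suc t) ja' tb' (suc i)) ⟨
      G' j t i + G (suc j) (suc t) (suc i) ∎)
      where
      open ≡-Reasoning
      ja' : a + suc j ≡ n
      ja' = trans (+-suc a j) ja
      tb' : b + suc t ≡ y
      tb' = trans (+-suc b t) tb
      j<n : j < n
      j<n = subst (suc j ≤_) ja' (m≤n+m (suc j) a)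
      t<y : t < y
      t<y = subst (suc t ≤_) tb' (m≤n+m (suc t) b)
      r₁ = growth-uniqueᵇ′ top right a (suc b) (suc j) t ja' tb
      r₂ = growth-uniqueᵇ′ top right (suc a) b j (suc t) ja tb'

  growth-uniqueᵇ : (∀ j → j ≤ n → ∀ i → G j y i ≡ G' j y i) →
    (∀ t → t ≤ y → ∀ i → G n t i ≡ G' n t i) →
    ∀ j t i → j ≤ n → t ≤ y → G j t i ≡ G' j t i
  growth-uniqueᵇ top right j t i j≤n t≤y =
    growth-uniqueᵇ′ top right (n ∸ j) (y ∸ t) j t (m∸n+n≡m j≤n) (m∸n+n≡m t≤y) i

-- Sizes of the partitions and the matrix of jumps

module _ {n y : ℕ} {G : ℕ → ℕ → ℕ → ℕ} (gr : Growth n y G) where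
  open Growth gr

  size : ℕ → ℕ → ℕ
  size j t = ∑ y (G j t)

  -- Sum the local rule over all parts. Minima and maxima recombine into the sizes of the two middle
  -- partitions, and the index shifts leave `k 0` and `m 0 ⊔ o 0` over; by `vanish` nothing is lost
  -- at index `y`.
  growth-size : ∀ j t → j < n → t < y →
    size (suc j) (suc t) + size j t + (G (suc j) t 0 ⊔ G j (suc t) 0)
      ≡ size (suc j) t + size j (suc t) + G (suc j) (suc t) 0
  growth-size j t j<n t<y = begin
    ∑ y k + ∑ y l + (m 0 ⊔ o 0)
      ≡⟨ cong (λ s → s + ∑ y l + (m 0 ⊔ o 0)) (shift-zero k (vanish (suc j) (suc t) y j<n t<y t<y)) ⟩
    (∑ y (k ∘ suc) + k 0) + ∑ y l + (m 0 ⊔ o 0)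
      ≡⟨ cong (_+ (m 0 ⊔ o 0)) (xy∙z≈xz∙y (∑ y (k ∘ suc)) (k 0) (∑ y l)) ⟩
    (∑ y (k ∘ suc) + ∑ y l) + k 0 + (m 0 ⊔ o 0)
      ≡⟨ xy∙z≈xz∙y (∑ y (k ∘ suc) + ∑ y l) (k 0) (m 0 ⊔ o 0) ⟩
    (∑ y (k ∘ suc) + ∑ y l) + (m 0 ⊔ o 0) + k 0
      ≡⟨ cong (λ s → s + (m 0 ⊔ o 0) + k 0)
          (trans (+-comm (∑ y (k ∘ suc)) (∑ y l)) (sym (∑-distrib-+ y l (k ∘ suc)))) ⟩
    ∑ y (λ i → l i + k (suc i)) + (m 0 ⊔ o 0) + k 0
      ≡⟨ cong (λ s → s + (m 0 ⊔ o 0) + k 0) (∑-cong y λ i _ → cell j t j<n t<y i) ⟩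
    ∑ y (λ i → (m i ⊓ o i) + (m (suc i) ⊔ o (suc i))) + (m 0 ⊔ o 0) + k 0
      ≡⟨ cong (λ s → s + (m 0 ⊔ o 0) + k 0) (∑-distrib-+ y _ _) ⟩
    (∑ y (λ i → m i ⊓ o i) + ∑ y (λ i → m (suc i) ⊔ o (suc i))) + (m 0 ⊔ o 0) + k 0
      ≡⟨ cong (_+ k 0) (+-assoc (∑ y (λ i → m i ⊓ o i)) _ _) ⟩
    ∑ y (λ i → m i ⊓ o i) + (∑ y (λ i → m (suc i) ⊔ o (suc i)) + (m 0 ⊔ o 0)) + k 0
      ≡⟨ cong (λ s → ∑ y (λ i → m i ⊓ o i) + s + k 0)
           (sym (shift-zero (λ i → m i ⊔ o i)
              (cong₂ _⊔_ (vanish (suc j) t y j<n (<⇒≤ t<y) (<⇒≤ t<y))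
                         (vanish j (suc t) y (<⇒≤ j<n) t<y t<y)))) ⟩
    ∑ y (λ i → m i ⊓ o i) + ∑ y (λ i → m i ⊔ o i) + k 0
      ≡⟨ cong (_+ k 0) (sym (∑-distrib-+ y _ _)) ⟩
    ∑ y (λ i → (m i ⊓ o i) + (m i ⊔ o i)) + k 0
      ≡⟨ cong (_+ k 0) (∑-cong y λ i _ → ⊓+⊔ (m i) (o i)) ⟩
    ∑ y (λ i → m i + o i) + k 0
      ≡⟨ cong (_+ k 0) (∑-distrib-+ y m o) ⟩
    ∑ y m + ∑ y o + k 0 ∎
    where
    open ≡-Reasoning
    l = G j t
    m = G (suc j) t
    o = G j (suc t)
    k = G (suc j) (suc t)
    shift-zero : ∀ (f : ℕ → ℕ) → f y ≡ 0 → ∑ y f ≡ ∑ y (f ∘ suc) + f 0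
    shift-zero f fy = sym (trans (∑-shift y f) (trans (cong (∑ y f +_) fy) (+-identityʳ _)))
    ⊓+⊔ : ∀ a b → (a ⊓ b) + (a ⊔ b) ≡ a + b
    ⊓+⊔ zero b = refl
    ⊓+⊔ (suc a) zero = +-comm 0 (suc a)
    ⊓+⊔ (suc a) (suc b) = cong suc (trans (+-suc _ _) (trans (cong suc (⊓+⊔ a b)) (sym (+-suc a b))))

  jump : ℕ → ℕ → ℕ
  jump j t = G (suc j) (suc t) 0 ∸ (G (suc j) t 0 ⊔ G j (suc t) 0)

  -- This is the last passage recursion with weight `jump j t`. The subtraction in `jump` is exact
  -- because first parts increase in both directions.
  jump-spec : ∀ j t → j < n → t < y →
    G (suc j) (suc t) 0 ≡ (G (suc j) t 0 ⊔ G j (suc t) 0) + jump j t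
  jump-spec j t j<n t<y =
    sym (m+[n∸m]≡n (⊔-lub (proj₁ (ver (suc j) t j<n t<y 0)) (proj₁ (hor j (suc t) j<n t<y 0))))

  -- The jump is the mixed second difference of `size`. Since the size is zero on the axes, summing
  -- along a strip gives `size-row` and `size-column`.
  size-step : ∀ j t → j < n → t < y →
    size (suc j) (suc t) + size j t ≡ size (suc j) t + size j (suc t) + jump j t
  size-step j t j<n t<y = +-cancelʳ-≡ (G (suc j) t 0 ⊔ G j (suc t) 0) _ _ (begin
    size (suc j) (suc t) + size j t + M
      ≡⟨ growth-size j t j<n t<y ⟩
    size (suc j) t + size j (suc t) + G (suc j) (suc t) 0
      ≡⟨ cong (size (suc j) t + size j (suc t) +_) (trans (jump-spec j t j<n t<y) (+-comm M _)) ⟩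
    size (suc j) t + size j (suc t) + (jump j t + M)
      ≡⟨ +-assoc (size (suc j) t + size j (suc t)) _ _ ⟨
    size (suc j) t + size j (suc t) + jump j t + M ∎)
    where
    open ≡-Reasoning
    M = G (suc j) t 0 ⊔ G j (suc t) 0

  size-row : ∀ j T → j < n → T ≤ y → size (suc j) T ≡ size j T + ∑ T (jump j)
  size-row j zero j<n _ = trans (size0 (suc j) j<n) (sym (trans (+-identityʳ _) (size0 j (<⇒≤ j<n))))
    where
    size0 : ∀ j → j ≤ n → size j 0 ≡ 0
    size0 j j≤n = ∑-zero y λ i _ → bottom j j≤n i
  size-row j (suc t) j<n t<y = +-cancelʳ-≡ (size j t) _ _ (begin
    size (suc j) (suc t) + size j t ≡⟨ size-step j t j<n t<y ⟩
    size (suc j) t + size j (suc t) + jump j t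
      ≡⟨ cong (λ s → s + size j (suc t) + jump j t) (size-row j t j<n (<⇒≤ t<y)) ⟩
    size j t + ∑ t (jump j) + size j (suc t) + jump j t
      ≡⟨ lemma (size j t) (∑ t (jump j)) (size j (suc t)) (jump j t) ⟩
    size j (suc t) + (∑ t (jump j) + jump j t) + size j t ∎)
    where
    open ≡-Reasoning
    lemma : ∀ a b c d → a + b + c + d ≡ c + (b + d) + a
    lemma = solve-∀

  size-column : ∀ J t → J ≤ n → t < y → size J (suc t) ≡ size J t + ∑ J (λ j → jump j t)
  size-column zero t _ t<y = trans (size0 (suc t) t<y) (sym (trans (+-identityʳ _) (size0 t (<⇒≤ t<y))))
    where
    size0 : ∀ t → t ≤ y → size 0 t ≡ 0
    size0 t t≤y = ∑-zero y λ i _ → left t t≤y i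
  size-column (suc j) t j<n t<y = +-cancelʳ-≡ (size j t) _ _ (begin
    size (suc j) (suc t) + size j t ≡⟨ size-step j t j<n t<y ⟩
    size (suc j) t + size j (suc t) + jump j t
      ≡⟨ cong (λ s → size (suc j) t + s + jump j t) (size-column j t (<⇒≤ j<n) t<y) ⟩
    size (suc j) t + (size j t + ∑ j (λ j → jump j t)) + jump j t
      ≡⟨ lemma (size (suc j) t) (size j t) (∑ j (λ j → jump j t)) (jump j t) ⟩
    size (suc j) t + (∑ j (λ j → jump j t) + jump j t) + size j t ∎)
    where
    open ≡-Reasoning
    lemma : ∀ a b c d → a + (b + c) + d ≡ a + (c + d) + b
    lemma = solve-∀

-- Lists and paths as sequences

ix : {X : Set} → X → List X → ℕ → X
ix d [] _ = d
ix d (a ∷ as) zero = a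
ix d (a ∷ as) (suc p) = ix d as p

nth≡ix : ∀ as p → nth as p ≡ ix 0 as p
nth≡ix [] p = refl
nth≡ix (a ∷ as) zero = refl
nth≡ix (a ∷ as) (suc p) = nth≡ix as p

ix-ext : ∀ {X : Set} {d : X} xs ys → length xs ≡ length ys →
  (∀ p → p < length xs → ix d xs p ≡ ix d ys p) → xs ≡ ys
ix-ext [] [] _ _ = refl
ix-ext (x ∷ xs) (y ∷ ys) len eq =
  cong₂ _∷_ (eq 0 z<s) (ix-ext xs ys (suc-injective len) λ p p< → eq (suc p) (s<s p<))

ix-applyUpTo : ∀ {X : Set} {d : X} f n {p} → p < n → ix d (applyUpTo f n) p ≡ f p
ix-applyUpTo f (suc n) {zero} _ = refl
ix-applyUpTo f (suc n) {suc p} (s≤s p<n) = ix-applyUpTo (f ∘ suc) n p<n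

ix-map-upTo : ∀ {X : Set} {d : X} f n {p} → p < n → ix d (map f (upTo n)) p ≡ f p
ix-map-upTo f n p<n rewrite map-upTo f n = ix-applyUpTo f n p<n

length-map-upTo : ∀ {X : Set} (f : ℕ → X) n → length (map f (upTo n)) ≡ n
length-map-upTo f n = trans (length-map f (upTo n)) (length-upTo n)

ix-beyond : ∀ {X : Set} {d : X} xs {p} → length xs ≤ p → ix d xs p ≡ d
ix-beyond [] _ = refl
ix-beyond (x ∷ xs) {suc p} (s≤s le) = ix-beyond xs le

∑-applyUpTo : ∀ n (f : ℕ → Bool) → boolCount (applyUpTo f n) ≡ ∑ n (bit ∘ f)
∑-applyUpTo zero f = refl
∑-applyUpTo (suc n) f = trans (head-eq (f 0)) (sym (∑-head n (bit ∘ f)))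
  where
  head-eq : ∀ b → boolCount (b ∷ applyUpTo (f ∘ suc) n) ≡ bit b + ∑ n (bit ∘ f ∘ suc)
  head-eq false = ∑-applyUpTo n (f ∘ suc)
  head-eq true = cong suc (∑-applyUpTo n (f ∘ suc))

boolCount-upTo : ∀ (f : ℕ → Bool) n → boolCount (map f (upTo n)) ≡ ∑ n (bit ∘ f)
boolCount-upTo f n rewrite map-upTo f n = ∑-applyUpTo n f

boolCount-cons : ∀ b bs → boolCount (b ∷ bs) ≡ bit b + boolCount bs
boolCount-cons false bs = refl
boolCount-cons true bs = refl

boolCount-++ : ∀ bs cs → boolCount (bs ++ cs) ≡ boolCount bs + boolCount cs
boolCount-++ [] cs = refl
boolCount-++ (false ∷ bs) cs = boolCount-++ bs cs
boolCount-++ (true ∷ bs) cs = cong suc (boolCount-++ bs cs)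

boolCount-map : ∀ (f : ℕ → Bool) xs → boolCount (map f xs) ≡ ∑ (length xs) (λ p → bit (f (ix 0 xs p)))
boolCount-map f [] = refl
boolCount-map f (a ∷ xs) = trans (boolCount-cons (f a) _)
  (trans (cong (bit (f a) +_) (boolCount-map f xs)) (sym (∑-head (length xs) _)))

boolCount-zipWith : ∀ (f : ℕ → ℕ → Bool) xs ys → length xs ≡ length ys →
  boolCount (zipWith f xs ys) ≡ ∑ (length xs) (λ p → bit (f (ix 0 xs p) (ix 0 ys p)))
boolCount-zipWith f [] [] _ = refl
boolCount-zipWith f (a ∷ xs) (b ∷ ys) len = trans (boolCount-cons (f a b) _)
  (trans (cong (bit (f a b) +_) (boolCount-zipWith f xs ys (suc-injective len))) (sym (∑-head (length xs) _)))

module _ {X : Set} {d : X} {P : X → Set} where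
  All⇒ix : ∀ {xs} → All P xs → ∀ p → p < length xs → P (ix d xs p)
  All⇒ix (px ∷ pxs) zero _ = px
  All⇒ix (px ∷ pxs) (suc p) (s≤s p<) = All⇒ix pxs p p<

  ix⇒All : ∀ xs → (∀ p → p < length xs → P (ix d xs p)) → All P xs
  ix⇒All [] _ = []
  ix⇒All (x ∷ xs) h = h 0 z<s ∷ ix⇒All xs λ p p< → h (suc p) (s<s p<)

module _ {X : Set} {d : X} {R : X → X → Set} where
  Linked⇒ix : ∀ {xs} → Linked R xs → ∀ p → suc p < length xs → R (ix d xs p) (ix d xs (suc p))
  Linked⇒ix (r ∷ rs) zero _ = r
  Linked⇒ix (r ∷ rs) (suc p) (s≤s p<) = Linked⇒ix rs p p<
  Linked⇒ix [-] p (s≤s ())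

  ix⇒Linked : ∀ xs → (∀ p → suc p < length xs → R (ix d xs p) (ix d xs (suc p))) → Linked R xs
  ix⇒Linked [] _ = []
  ix⇒Linked (x ∷ []) _ = [-]
  ix⇒Linked (x ∷ x' ∷ xs) h = h 0 (s<s z<s) ∷ ix⇒Linked (x' ∷ xs) λ p p< → h (suc p) (s<s p<)

module _ {X Y : Set} {d : X} {e : Y} {R : X → Y → Set} where
  Pointwise⇒ix : ∀ {xs ys} → Pointwise R xs ys → ∀ p → p < length xs → R (ix d xs p) (ix e ys p)
  Pointwise⇒ix (r ∷ rs) zero _ = r
  Pointwise⇒ix (r ∷ rs) (suc p) (s≤s p<) = Pointwise⇒ix rs p p<

  ix⇒Pointwise : ∀ xs ys → length xs ≡ length ys →
    (∀ p → p < length xs → R (ix d xs p) (ix e ys p)) → Pointwise R xs ys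
  ix⇒Pointwise [] [] _ _ = []
  ix⇒Pointwise (x ∷ xs) (y ∷ ys) len h =
    h 0 z<s ∷ ix⇒Pointwise xs ys (suc-injective len) λ p p< → h (suc p) (s<s p<)

Linked⇒Sorted : ∀ {xs} → Linked _≤_ xs → Sorted (length xs) (ix 0 xs)
Linked⇒Sorted linked = sorted-from-steps (Linked⇒ix linked)

Sorted⇒Linked : ∀ xs → Sorted (length xs) (ix 0 xs) → Linked _≤_ xs
Sorted⇒Linked xs sorted = ix⇒Linked xs λ p p< → sorted p (suc p) (n≤1+n p) p<

-- Paths and the heights of their east steps

length-eastHeightsFrom : ∀ h P → length (eastHeightsFrom h P) ≡ countStep E P
length-eastHeightsFrom h [] = refl
length-eastHeightsFrom h (N ∷ P) = length-eastHeightsFrom (suc h) P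
length-eastHeightsFrom h (E ∷ P) = cong suc (length-eastHeightsFrom h P)

eastHeightsFrom-≥ : ∀ h P → All (h ≤_) (eastHeightsFrom h P)
eastHeightsFrom-≥ h [] = []
eastHeightsFrom-≥ h (N ∷ P) = All.map <⇒≤ (eastHeightsFrom-≥ (suc h) P)
eastHeightsFrom-≥ h (E ∷ P) = ≤-refl ∷ eastHeightsFrom-≥ h P

eastHeightsFrom-≤ : ∀ h P → All (_≤ h + countStep N P) (eastHeightsFrom h P)
eastHeightsFrom-≤ h [] = []
eastHeightsFrom-≤ h (N ∷ P) = 
  subst (λ m → All (_≤ m) (eastHeightsFrom (suc h) P)) (sym (+-suc h _)) (eastHeightsFrom-≤ (suc h) P)
eastHeightsFrom-≤ h (E ∷ P) = m≤m+n h _ ∷ eastHeightsFrom-≤ h P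

eastHeightsFrom-linked : ∀ h P → Linked _≤_ (eastHeightsFrom h P)
eastHeightsFrom-linked h [] = []
eastHeightsFrom-linked h (N ∷ P) = eastHeightsFrom-linked (suc h) P
eastHeightsFrom-linked h (E ∷ P) = cons (eastHeightsFrom-≥ h P) (eastHeightsFrom-linked h P)
  where
  cons : ∀ {xs} → All (h ≤_) xs → Linked _≤_ xs → Linked _≤_ (h ∷ xs)
  cons [] [] = [-]
  cons (h≤x ∷ _) linked = h≤x ∷ linked

-- East heights determine everything but the final run of north steps, and the total number of north
-- steps fixes that.
eastHeightsFrom-injective : ∀ h P Q → eastHeightsFrom h P ≡ eastHeightsFrom h Q →
  countStep N P ≡ countStep N Q → P ≡ Q
eastHeightsFrom-injective h [] [] _ _ = refl
eastHeightsFrom-injective h [] (N ∷ Q) _ ()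
eastHeightsFrom-injective h [] (E ∷ Q) () _
eastHeightsFrom-injective h (N ∷ P) [] _ ()
eastHeightsFrom-injective h (E ∷ P) [] () _
eastHeightsFrom-injective h (N ∷ P) (N ∷ Q) eq n =
  cong (N ∷_) (eastHeightsFrom-injective (suc h) P Q eq (suc-injective n))
eastHeightsFrom-injective h (E ∷ P) (E ∷ Q) eq n =
  cong (E ∷_) (eastHeightsFrom-injective h P Q (proj₂ (∷-injective eq)) n)
eastHeightsFrom-injective h (N ∷ P) (E ∷ Q) eq n =
  ⊥-elim (<-irrefl refl (All.head (subst (All (suc h ≤_)) eq (eastHeightsFrom-≥ (suc h) P))))
eastHeightsFrom-injective h (E ∷ P) (N ∷ Q) eq n =
  ⊥-elim (<-irrefl refl (All.head (subst (All (suc h ≤_)) (sym eq) (eastHeightsFrom-≥ (suc h) Q))))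

pathFrom : ℕ → ℕ → List ℕ → Path
pathFrom y h [] = rep (y ∸ h) N
pathFrom y h (e ∷ es) = rep (e ∸ h) N ++ E ∷ pathFrom y e es

private
  eastHeightsFrom-rise : ∀ h m P → eastHeightsFrom h (rep m N ++ P) ≡ eastHeightsFrom (m + h) P
  eastHeightsFrom-rise h zero P = refl
  eastHeightsFrom-rise h (suc m) P =
    trans (eastHeightsFrom-rise (suc h) m P) (cong (λ n → eastHeightsFrom n P) (+-suc m h))

  countStep-rise : ∀ m P → countStep N (rep m N ++ P) ≡ m + countStep N P
  countStep-rise zero P = refl
  countStep-rise (suc m) P = cong suc (countStep-rise m P)

eastHeights-pathFrom : ∀ y h es → Linked _≤_ (h ∷ es) → eastHeightsFrom h (pathFrom y h es) ≡ es
eastHeights-pathFrom y h [] _ =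
  trans (cong (eastHeightsFrom h) (sym (++-identityʳ (rep (y ∸ h) N)))) (eastHeightsFrom-rise h (y ∸ h) [])
eastHeights-pathFrom y h (e ∷ es) (h≤e ∷ linked)
  rewrite eastHeightsFrom-rise h (e ∸ h) (E ∷ pathFrom y e es) | m∸n+n≡m h≤e =
  cong (e ∷_) (eastHeights-pathFrom y e es linked)

countN-pathFrom : ∀ y h es → Linked _≤_ (h ∷ es) → All (_≤ y) (h ∷ es) → h + countStep N (pathFrom y h es) ≡ y
countN-pathFrom y h [] _ (h≤y ∷ _) =
  trans (cong (h +_) (trans (cong (countStep N) (sym (++-identityʳ (rep (y ∸ h) N)))) (countStep-rise (y ∸ h) [])))
    (trans (cong (h +_) (+-identityʳ _)) (m+[n∸m]≡n h≤y))
countN-pathFrom y h (e ∷ es) (h≤e ∷ linked) (_ ∷ all≤y)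
  rewrite countStep-rise (e ∸ h) (E ∷ pathFrom y e es)
  | sym (+-assoc h (e ∸ h) (countStep N (pathFrom y e es)))
  | m+[n∸m]≡n h≤e = countN-pathFrom y e es linked all≤y

ix-topPath : ∀ x y {p} → p < x → ix 0 (eastHeights (topPath x y)) p ≡ y
ix-topPath x y p<x rewrite eastHeightsFrom-rise 0 y (rep x E) | +-identityʳ y = go x p<x
  where
  go : ∀ x {p} → p < x → ix 0 (eastHeightsFrom y (rep x E)) p ≡ y
  go (suc x) {zero} _ = refl
  go (suc x) {suc p} (s≤s p<x) = go x p<x

topPath-to : ∀ x y → PathTo x y (topPath x y)
topPath-to x zero = east x , flat x
  where
  east : ∀ x → countStep E (rep x E) ≡ x
  east zero = refl
  east (suc x) = cong suc (east x)
  flat : ∀ x → countStep N (rep x E) ≡ 0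
  flat zero = refl
  flat (suc x) = flat x
topPath-to x (suc y) = proj₁ (topPath-to x y) , cong suc (proj₂ (topPath-to x y))

≡ᵇ-yes : ∀ a → (a ≡ᵇ a) ≡ true
≡ᵇ-yes zero = refl
≡ᵇ-yes (suc a) = ≡ᵇ-yes a

≡ᵇ-no : ∀ a b → a ≢ b → (a ≡ᵇ b) ≡ false
≡ᵇ-no zero zero ne = ⊥-elim (ne refl)
≡ᵇ-no zero (suc b) ne = refl
≡ᵇ-no (suc a) zero ne = refl
≡ᵇ-no (suc a) (suc b) ne = ≡ᵇ-no a b (ne ∘ cong suc)

<ᵇ-yes : ∀ {a t} → a < t → (a <ᵇ t) ≡ true
<ᵇ-yes {zero} {suc t} _ = refl
<ᵇ-yes {suc a} {suc t} (s≤s p) = <ᵇ-yes p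

-- An east step of the upper path at height a above one of the lower path at height b < a
-- contributes exactly one jump, at level b; coinciding steps contribute none.
jumps-over : ∀ y a b → b ≤ a → a ≤ y →
  ∑ y (λ t → lt b (suc t)) + bit (a ≡ᵇ b) ≡ ∑ y (λ t → lt b t ⊔ lt a (suc t)) + 1
jumps-over y a b b≤a a≤y with m≤n⇒m<n∨m≡n b≤a
... | inj₂ refl rewrite ≡ᵇ-yes b = cong (_+ 1) (∑-cong y λ t _ →
        sym (m≤n⇒m⊔n≡n (lt-mono {b} {t} m<n⇒m<1+n)))
... | inj₁ b<a rewrite ≡ᵇ-no a b (>⇒≢ b<a) = trans (∑-shift y (lt b))
        (cong₂ _+_ (∑-cong y λ t _ → sym (m≥n⇒m⊔n≡m (lt-mono λ a≤t → <-≤-trans b<a (≤-pred a≤t))))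
                   (lt-yes (<-≤-trans b<a a≤y)))

-- Sum `jumps-over` over the columns, exchange the two sums, and let `cnt-⊔` turn the maxima of
-- indicators into maxima of counts. Together with the last passage recursion this evaluates a row
-- sum of jumps.
coincide-count : ∀ {x y a b} → Sorted x a → Sorted x b →
  (∀ p → p < x → b p ≤ a p) → (∀ p → p < x → a p ≤ y) →
  ∑ y (λ t → cnt x b (suc t)) + ∑ x (λ p → bit (a p ≡ᵇ b p))
    ≡ ∑ y (λ t → cnt x b t ⊔ cnt x a (suc t)) + x
coincide-count {x} {y} {a} {b} sa sb b≤a a≤y = begin
  ∑ y (λ t → ∑ x λ p → lt (b p) (suc t)) + ∑ x (λ p → bit (a p ≡ᵇ b p))
    ≡⟨ cong (_+ ∑ x (λ p → bit (a p ≡ᵇ b p))) (∑-swap y x λ t p → lt (b p) (suc t)) ⟩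
  ∑ x (λ p → ∑ y λ t → lt (b p) (suc t)) + ∑ x (λ p → bit (a p ≡ᵇ b p))
    ≡⟨ ∑-distrib-+ x _ _ ⟨
  ∑ x (λ p → ∑ y (λ t → lt (b p) (suc t)) + bit (a p ≡ᵇ b p))
    ≡⟨ ∑-cong x (λ p p<x → jumps-over y (a p) (b p) (b≤a p p<x) (a≤y p p<x)) ⟩
  ∑ x (λ p → ∑ y (λ t → lt (b p) t ⊔ lt (a p) (suc t)) + 1)
    ≡⟨ ∑-distrib-+ x _ _ ⟩
  ∑ x (λ p → ∑ y (λ t → lt (b p) t ⊔ lt (a p) (suc t))) + ∑ x (λ _ → 1)
    ≡⟨ cong₂ _+_ (sym (∑-swap y x λ t p → lt (b p) t ⊔ lt (a p) (suc t))) (∑-one x λ _ _ → refl) ⟩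
  ∑ y (λ t → ∑ x (λ p → lt (b p) t ⊔ lt (a p) (suc t))) + x
    ≡⟨ cong (_+ x) (∑-cong y λ t _ → sym (cnt-⊔ sb sa t (suc t))) ⟩
  ∑ y (λ t → cnt x b t ⊔ cnt x a (suc t)) + x ∎
  where open ≡-Reasoning

descending : ∀ {v vs} → Linked _≥_ (v ∷ vs) → All (_≤ v) vs
descending [-] = []
descending (v≥w ∷ ws) = v≥w ∷ All.map (λ z≤w → ≤-trans z≤w v≥w) (descending ws)

-- A height t below v avoids the descending sequence vs and exceeds b iff exactly one
-- pair of neighbours in v ∷ vs ++ b ∷ [] lies strictly on both sides of t.  The summands
-- lt (a j) (suc t), added on both sides, turn the indicator of such a pair into a maximum.
straddle : ∀ t v vs b → t < v → Linked _≥_ (v ∷ vs ++ b ∷ []) →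
  let a = ix 0 (v ∷ vs ++ b ∷ []) ; n = suc (length vs) in
  bit ((b <ᵇ t) ∧ not (anyB (map (_≡ᵇ t) vs))) + ∑ n (λ j → lt (a j) (suc t))
    ≡ ∑ n (λ j → lt (a (suc j)) t ⊔ lt (a j) (suc t))
straddle t v [] b t<v _ rewrite lt-no t<v | ∧-identityʳ (b <ᵇ t) =
  trans (+-identityʳ (lt b t)) (sym (⊔-identityʳ (lt b t)))
straddle t v (w ∷ vs) b t<v (v≥w ∷ chain) = begin
  lhs + ∑ (suc n) (λ j → lt (a j) (suc t))
    ≡⟨ cong (lhs +_) (trans (∑-head n _) (cong (_+ ∑ n low) (lt-no t<v))) ⟩
  lhs + ∑ n low
    ≡⟨ step ⟩
  lt w t + ∑ n high
    ≡⟨ cong (_+ ∑ n high) (trans (sym (⊔-identityʳ (lt w t))) (cong (lt w t ⊔_) (sym (lt-no t<v)))) ⟩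
  (lt w t ⊔ lt v (suc t)) + ∑ n high
    ≡⟨ ∑-head n _ ⟨
  ∑ (suc n) (λ j → lt (a (suc j)) t ⊔ lt (a j) (suc t)) ∎
  where
  open ≡-Reasoning
  n = suc (length vs)
  a = ix 0 (v ∷ w ∷ vs ++ b ∷ [])
  lhs = bit ((b <ᵇ t) ∧ not (anyB (map (_≡ᵇ t) (w ∷ vs))))
  low = λ j → lt (a (suc j)) (suc t)
  high = λ j → lt (a (suc (suc j))) t ⊔ lt (a (suc j)) (suc t)
  length-tail : suc (suc (length vs)) ≡ length (w ∷ vs ++ b ∷ [])
  length-tail = cong suc (sym (trans (length-++ vs) (+-comm (length vs) 1)))
  below-w : All (_≤ w) (w ∷ vs ++ b ∷ [])
  below-w = ≤-refl ∷ descending chain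
  -- From `w` on every value is at most `t`, so each summand on either side is 1.
  settled : w ≤ t → ∑ n low ≡ ∑ n high
  settled w≤t = ∑-cong n λ j j<n → sym (m≤n⇒m⊔n≡n
    (lt-mono {a (suc (suc j))} {t} λ _ → s≤s (≤-trans (All⇒ix below-w j (subst (j <_) length-tail (m<n⇒m<1+n j<n))) w≤t)))
  last≤ : ∀ us → All (_≤ w) (us ++ b ∷ []) → b ≤ w
  last≤ [] (b≤w ∷ []) = b≤w
  last≤ (u ∷ us) (_ ∷ rest) = last≤ us rest
  none : ∀ us → w < t → All (_≤ w) (us ++ b ∷ []) → anyB (map (_≡ᵇ t) us) ≡ false
  none [] _ _ = refl
  none (u ∷ us) w<t (u≤w ∷ rest) rewrite ≡ᵇ-no u t (<⇒≢ (≤-<-trans u≤w w<t)) = none us w<t rest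
  step : lhs + ∑ n low ≡ lt w t + ∑ n high
  step with <-cmp w t
  -- If `w > t`, the straddling pair can only come later, and `w` takes over the role of `v`. If
  -- `w = t`, the height is used and no pair straddles it. If `w < t`, the pair is `v`, `w` itself,
  -- and no later value can meet `t`.
  ... | tri> _ w≢t t<w rewrite ≡ᵇ-no w t w≢t | lt-no (<⇒≤ t<w) = straddle t w vs b t<w chain
  ... | tri≈ _ refl _ rewrite ≡ᵇ-yes w | ∧-zeroʳ (b <ᵇ w) | lt-no (≤-refl {w}) = settled ≤-refl
  ... | tri< w<t w≢t _ rewrite ≡ᵇ-no w t w≢t | none vs w<t (All.tail below-w)
          | <ᵇ-yes (≤-<-trans (last≤ vs (All.tail below-w)) w<t) | lt-yes w<t = cong suc (settled (<⇒≤ w<t))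

-- Fillings of a shape and edges of a growth diagram

-- With `n = suc k`, the bound `n + r` for rows counted from 0 is the bound `k + r` for rows counted
-- from 1.
record Filling (n : ℕ) (ℓ : ℕ → ℕ) (e : ℕ → ℕ → ℕ) : Set where
  field
    positive : ∀ r p → p < ℓ r → 1 ≤ e r p
    weak : ∀ r → Sorted (ℓ r) (e r)
    strict : ∀ r p → p < ℓ (suc r) → e r p < e (suc r) p
    flag : ∀ r p → p < ℓ r → e r p ≤ n + r

atMost : (ℓ : ℕ → ℕ) (e : ℕ → ℕ → ℕ) → ℕ → ℕ → ℕ
atMost ℓ e r m = cnt (ℓ r) (e r) (suc m)

-- Rows are numbered from 0, so the flag makes row s full in the entries ≤ n + s.
record Edges (n y : ℕ) (G : ℕ → ℕ → ℕ → ℕ) (C : ℕ → ℕ → ℕ) : Set where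
  field
    top : ∀ m → m ≤ n → ∀ r → G m y r ≡ C r m
    right : ∀ s → s ≤ y → ∀ i → G n (y ∸ s) i ≡ C (s + i) (n + s)

module _ {n y : ℕ} {ℓ : ℕ → ℕ} {e : ℕ → ℕ → ℕ} (ℓ-antitone : ∀ r → ℓ (suc r) ≤ ℓ r)
  (ℓ-end : ∀ r → y ≤ r → ℓ r ≡ 0) (F : Filling n ℓ e) where
  open Filling F
  private C = atMost ℓ e

  atMost-zero : ∀ r → C r 0 ≡ 0
  atMost-zero r = cnt-none (ℓ r) (e r) 1 (positive r)

  atMost-flag : ∀ {r m} → n + r ≤ m → C r m ≡ ℓ r
  atMost-flag {r} n+r≤m = cnt-all (ℓ r) (e r) _ λ p p<ℓ → s≤s (≤-trans (flag r p p<ℓ) n+r≤m)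

  atMost-end : ∀ r m → y ≤ r → C r m ≡ 0
  atMost-end r m y≤r rewrite ℓ-end r y≤r = refl

  atMost-suc : ∀ r m → C r m ≤ C r (suc m)
  atMost-suc r m = cnt-monoʳ (ℓ r) (e r) (n≤1+n (suc m))

  -- The cell above an entry at most `suc m` exists because the rows shorten downwards, and it holds
  -- an entry at most `m`.
  atMost-strict : ∀ r m → C (suc r) (suc m) ≤ C r m
  atMost-strict r m = ≤-trans (cnt-mono (ℓ (suc r)) λ p p<ℓ e<2+m → <-≤-trans (strict r p p<ℓ) (≤-pred e<2+m))
    (cnt-length (ℓ-antitone r))
    where
    cnt-length : ∀ {x x'} → x ≤ x' → cnt x (e r) (suc m) ≤ cnt x' (e r) (suc m)
    cnt-length {x} {x'} x≤x' = subst (λ z → cnt x (e r) (suc m) ≤ cnt z (e r) (suc m)) (m+[n∸m]≡n x≤x')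
      (≤-trans (m≤m+n _ _) (≤-reflexive (sym (∑-split x (x' ∸ x) _))))

  private
    U R : ℕ → ℕ → ℕ
    U a r = C r (n ∸ a)
    R b i = C (b + i) (n + b)

    corner : ∀ i → U 0 i ≡ R 0 i
    corner i = cong (C i) (sym (+-identityʳ n))

    U-chain : ∀ a → a < n → U (suc a) ≺ U a
    U-chain a a<n i rewrite +-∸-assoc 1 a<n = atMost-suc i _ , atMost-strict i _

    -- Compared with `U-chain` the two halves of `≺` trade places: column strictness yields the
    -- containment, monotonicity in the bound yields the interlacing.
    R-chain : ∀ b → b < y → R (suc b) ≺ R b
    R-chain b _ i rewrite +-suc n b | +-suc b i = atMost-strict (b + i) (n + b) , atMost-suc (suc (b + i)) (n + b)

    U-end : ∀ i → U n i ≡ 0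
    U-end i = trans (cong (C i) (n∸n≡0 n)) (atMost-zero i)

    R-end : ∀ i → R y i ≡ 0
    R-end i = atMost-end (y + i) _ (m≤m+n y i)

  filling-diagram : ℕ → ℕ → ℕ → ℕ
  filling-diagram j t = backward U R (n ∸ j) (y ∸ t)

  filling-growth : Growth n y filling-diagram
  filling-growth = backward-growth {n} {y} {U} {R} corner U-chain R-chain U-end R-end

  filling-edges : Edges n y filling-diagram C
  filling-edges = record { top = top' ; right = right' }
    where
    top' : ∀ m → m ≤ n → ∀ r → filling-diagram m y r ≡ C r m
    top' m m≤n r rewrite n∸n≡0 y with n ∸ m in eq
    -- At the corner `backward` takes its value from `R`, so `m = n` is read off the right edge.
    ... | zero = trans (cong (C (0 + r)) (+-identityʳ n)) (cong (C r) (≤-antisym (m∸n≡0⇒m≤n eq) m≤n))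
    ... | suc a = cong (C r) (trans (cong (n ∸_) (sym eq)) (m∸[m∸n]≡n m≤n))
    right' : ∀ s → s ≤ y → ∀ i → filling-diagram n (y ∸ s) i ≡ C (s + i) (n + s)
    right' s s≤y i rewrite n∸n≡0 n | m∸[m∸n]≡n s≤y = refl

module _ {n y : ℕ} {G : ℕ → ℕ → ℕ → ℕ} (gr : Growth n y G) where
  open Growth gr

  private
    -- `Edges` read in reverse, for both edges at once. The count for the bound `n + s` in row `r`
    -- is part `r ∸ s` at height `y ∸ s`; once `s` reaches `r` the row is full, and `s ⊓ r` freezes
    -- the count at the first part of `G n (y ∸ r)`. For bounds up to `n` one has `s = 0`, which is
    -- the top edge.
    cut : ℕ → ℕ → ℕ → ℕ
    cut j s r = G j (y ∸ (s ⊓ r)) (r ∸ (s ⊓ r))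

    C : ℕ → ℕ → ℕ
    C r m = cut (m ⊓ n) (m ∸ n) r

    low : ∀ {m} r → m ≤ n → C r m ≡ G m y r
    low r m≤n rewrite m≤n⇒m⊓n≡m m≤n | m≤n⇒m∸n≡0 m≤n = refl

    high : ∀ r s → C r (n + s) ≡ cut n s r
    high r s rewrite m≥n⇒m⊓n≡n (m≤m+n n s) | m+n∸m≡n n s = refl

    data View (m : ℕ) : Set where
      lower : m < n → View m
      upper : ∀ s → n + s ≡ m → View m

    view : ∀ m → View m
    view m with <-≤-connex m n
    ... | inj₁ m<n = lower m<n
    ... | inj₂ n≤m = upper (m ∸ n) (m+[n∸m]≡n n≤m)

    right-suc : ∀ s i → G n (y ∸ s) (suc i) ≤ G n (y ∸ suc s) i
    right-suc s i with <-≤-connex s y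
    ... | inj₁ s<y rewrite +-∸-assoc 1 s<y = proj₂ (ver n _ ≤-refl y∸s<y i)
      where
      y∸s<y : y ∸ suc s < y
      y∸s<y = subst (_≤ y) (+-∸-assoc 1 s<y) (m∸n≤m y s)
    ... | inj₂ y≤s rewrite m≤n⇒m∸n≡0 y≤s | bottom n ≤-refl (suc i) = z≤n

    right-pred : ∀ s i → G n (y ∸ suc s) i ≤ G n (y ∸ s) i
    right-pred s i with <-≤-connex s y
    ... | inj₁ s<y rewrite +-∸-assoc 1 s<y = proj₁ (ver n _ ≤-refl y∸s<y i)
      where
      y∸s<y : y ∸ suc s < y
      y∸s<y = subst (_≤ y) (+-∸-assoc 1 s<y) (m∸n≤m y s)
    ... | inj₂ y≤s rewrite m≤n⇒m∸n≡0 y≤s | m≤n⇒m∸n≡0 (m≤n⇒m≤1+n y≤s) = ≤-refl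

    cut-suc : ∀ s r → cut n s r ≤ cut n (suc s) r
    cut-suc s r with <-≤-connex s r
    ... | inj₁ s<r rewrite m≤n⇒m⊓n≡m (<⇒≤ s<r) | m≤n⇒m⊓n≡m s<r | +-∸-assoc 1 s<r = right-suc s _
    ... | inj₂ r≤s rewrite m≥n⇒m⊓n≡n r≤s | m≥n⇒m⊓n≡n (m≤n⇒m≤1+n r≤s) = ≤-refl

    C-suc : ∀ r m → C r m ≤ C r (suc m)
    C-suc r m with view m
    ... | lower m<n rewrite low r (<⇒≤ m<n) | low r m<n = proj₁ (hor m y m<n ≤-refl r)
    ... | upper s refl rewrite sym (+-suc n s) | high r s | high r (suc s) = cut-suc s r

    C-strict : ∀ r m → C (suc r) (suc m) ≤ C r m
    C-strict r m with view m
    ... | lower m<n rewrite low r (<⇒≤ m<n) | low (suc r) m<n = proj₂ (hor m y m<n ≤-refl r)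
    ... | upper s refl rewrite sym (+-suc n s) | high r s | high (suc r) (suc s) = right-pred (s ⊓ r) _

    C-zero : ∀ r → C r 0 ≡ 0
    C-zero r = trans (low r z≤n) (left y ≤-refl r)

    C-flag : ∀ r s → r ≤ s → C r (n + s) ≡ G n (y ∸ r) 0
    C-flag r s r≤s rewrite high r s | m≥n⇒m⊓n≡n r≤s | n∸n≡0 r = refl

    C-sorted : ∀ M r → Sorted M (C r)
    C-sorted M r = sorted-from-steps λ m _ → C-suc r m

    C≤ : ∀ r m → C r m ≤ G n (y ∸ r) 0
    C≤ r m = subst (C r m ≤_) (C-flag r (r ⊔ m) (m≤m⊔n r m))
      (C-sorted (suc (n + (r ⊔ m))) r m (n + (r ⊔ m)) (≤-trans (m≤n⊔m r m) (m≤n+m _ n)) ≤-refl)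

    -- Large enough to include every bound `n + s` with `s ≤ y` that occurs on the right edge.
    M = suc (n + y)

  -- The number of bounds `m` which admit at most `p` entries of row `r` is the least bound
  -- admitting more than `p`, and that is the entry in column `p`.
  diagram-filling : ℕ → ℕ → ℕ
  diagram-filling r p = conj M (C r) p

  module _ {ℓ : ℕ → ℕ} (ℓ-edge : ∀ r → G n (y ∸ r) 0 ≡ ℓ r) where
    private
      e = diagram-filling

      spec : ∀ r {m} p → m < M → (e r p < suc m → p < C r m) × (p < C r m → e r p < suc m)
      spec r p m<M = to (conj-spec (C-sorted M r) p m<M) , from (conj-spec (C-sorted M r) p m<M)

      nonempty : ∀ {r p} → p < ℓ r → r < y
      nonempty {r} p<ℓ = ≰⇒> λ y≤r → <⇒≱ (subst (_ <_) (sym (ℓ-edge r)) p<ℓ)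
        (subst (_≤ _) (sym (trans (cong (λ t → G n t 0) (m≤n⇒m∸n≡0 y≤r)) (bottom n ≤-refl 0))) z≤n)

      e≤ : ∀ r p → p < ℓ r → e r p ≤ n + r
      e≤ r p p<ℓ = ≤-pred (proj₂ (spec r p (s≤s (+-monoʳ-≤ n (<⇒≤ (nonempty p<ℓ)))))
        (subst (p <_) (sym (trans (C-flag r r ≤-refl) (ℓ-edge r))) p<ℓ))

    diagram-Filling : (∀ r → ℓ (suc r) ≤ ℓ r) → Filling n ℓ e
    diagram-Filling ℓ-antitone = record
      { positive = λ r p p<ℓ → ≰⇒> λ e≤0 →
          case subst (p <_) (C-zero r) (proj₁ (spec r p z<s) (s≤s e≤0)) of λ ()
      ; weak = λ r → conj-sorted M (C r) (ℓ r)
      ; strict = strict'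
      ; flag = e≤ }
      where
      strict' : ∀ r p → p < ℓ (suc r) → e r p < e (suc r) p
      strict' r p p<ℓ = ≰⇒> λ le → contra (e (suc r) p) ≤-refl le
        where
        -- Used with `m = e (suc r) p`. Splitting on `m` provides the predecessor that `C-strict`
        -- asks for: the entry above would be at most it.
        contra : ∀ m → e (suc r) p ≤ m → m ≤ e r p → ⊥
        contra zero e≤0 _ = <⇒≱ (proj₁ (spec (suc r) p z<s) (s≤s e≤0)) (subst (_≤ p) (sym (C-zero (suc r))) z≤n)
        contra (suc m) e≤1+m 1+m≤e = <⇒≱ 1+m≤e (≤-pred (proj₂ (spec r p m<M)
          (<-≤-trans (proj₁ (spec (suc r) p 1+m<M) (s≤s e≤1+m)) (C-strict r m))))
          where
          p<ℓr = ≤-trans p<ℓ (ℓ-antitone r)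
          1+m<M : suc m < M
          1+m<M = s≤s (≤-trans 1+m≤e (≤-trans (e≤ r p p<ℓr) (+-monoʳ-≤ n (<⇒≤ (nonempty p<ℓr)))))
          m<M = <-trans ≤-refl 1+m<M

    diagram-edges : Edges n y G (atMost ℓ e)
    diagram-edges = record
      { top = λ m m≤n r → trans (sym (low r m≤n)) (sym (count r m (s≤s (≤-trans m≤n (m≤m+n n y)))))
      ; right = λ s s≤y i → trans (sym (C-right s i)) (sym (count (s + i) (n + s) (s≤s (+-monoʳ-≤ n s≤y)))) }
      where
      count : ∀ r m → m < M → atMost ℓ e r m ≡ C r m
      count r m m<M = cnt-conj (C-sorted M r) (ℓ r) m<M (subst (C r m ≤_) (ℓ-edge r) (C≤ r m))
      C-right : ∀ s i → C (s + i) (n + s) ≡ G n (y ∸ s) i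
      C-right s i rewrite high (s + i) s | m≤n⇒m⊓n≡m (m≤m+n s i) | m+n∸m≡n s i = refl

-- Multiplicities of entries as sums of jumps

entries : ℕ → (ℕ → ℕ) → (ℕ → ℕ → ℕ) → ℕ → ℕ
entries y ℓ e i = ∑ y λ r → ∑ (ℓ r) λ p → bit (i ≡ᵇ e r p)

lt-suc : ∀ a t → lt a (suc t) ≡ lt a t + bit (t ≡ᵇ a)
lt-suc zero zero = refl
lt-suc zero (suc t) = refl
lt-suc (suc a) zero = refl
lt-suc (suc a) (suc t) = lt-suc a t

entries-atMost : ∀ y ℓ e m →
  ∑ y (λ r → atMost ℓ e r (suc m)) ≡ ∑ y (λ r → atMost ℓ e r m) + entries y ℓ e (suc m)
entries-atMost y ℓ e m = trans
  (∑-cong y λ r _ → trans (∑-cong (ℓ r) λ p _ → lt-suc (e r p) (suc m)) (∑-distrib-+ (ℓ r) _ _))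
  (∑-distrib-+ y _ _)

module _ {n y : ℕ} {ℓ : ℕ → ℕ} {e : ℕ → ℕ → ℕ} {G : ℕ → ℕ → ℕ → ℕ}
  (F : Filling n ℓ e) (gr : Growth n y G) (edges : Edges n y G (atMost ℓ e)) where
  open Growth gr
  open Edges edges
  private C = atMost ℓ e

  -- By `entries-atMost` the entries `suc m` make up the difference in size of two neighbours on the
  -- top edge, and `size-row` evaluates it.
  entries-low : ∀ m → m < n → entries y ℓ e (suc m) ≡ ∑ y (jump gr m)
  entries-low m m<n = +-cancelˡ-≡ (size gr m y) _ _ (begin
    size gr m y + entries y ℓ e (suc m)
      ≡⟨ cong (_+ entries y ℓ e (suc m)) (∑-cong y λ r _ → top m (<⇒≤ m<n) r) ⟩
    ∑ y (λ r → C r m) + entries y ℓ e (suc m) ≡⟨ entries-atMost y ℓ e m ⟨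
    ∑ y (λ r → C r (suc m)) ≡⟨ ∑-cong y (λ r _ → top (suc m) m<n r) ⟨
    size gr (suc m) y ≡⟨ size-row gr m y m<n ≤-refl ⟩
    size gr m y + ∑ y (jump gr m) ∎)
    where open ≡-Reasoning

  private
    -- The flag makes the first `s` rows full. The counts in the other rows are the parts of
    -- `G n (y ∸ s)`, and its sum extends from `y ∸ s` to `y` by `vanish`.
    rows-high : ∀ s → s ≤ y → ∑ y (λ r → C r (n + s)) ≡ ∑ s ℓ + size gr n (y ∸ s)
    rows-high s s≤y = begin
      ∑ y (λ r → C r (n + s))
        ≡⟨ cong (λ z → ∑ z λ r → C r (n + s)) (m+[n∸m]≡n s≤y) ⟨
      ∑ (s + (y ∸ s)) (λ r → C r (n + s))
        ≡⟨ ∑-split s (y ∸ s) _ ⟩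
      ∑ s (λ r → C r (n + s)) + ∑ (y ∸ s) (λ i → C (s + i) (n + s))
        ≡⟨ cong₂ _+_ (∑-cong s λ r r<s → full r (<⇒≤ r<s)) (∑-cong (y ∸ s) λ i _ → sym (right s s≤y i)) ⟩
      ∑ s ℓ + ∑ (y ∸ s) (G n (y ∸ s))
        ≡⟨ cong (∑ s ℓ +_) (+-identityʳ _) ⟨
      ∑ s ℓ + (∑ (y ∸ s) (G n (y ∸ s)) + 0)
        ≡⟨ cong (λ z → ∑ s ℓ + (∑ (y ∸ s) (G n (y ∸ s)) + z))
             (∑-zero s λ i _ → vanish n (y ∸ s) _ ≤-refl (m∸n≤m y s) (m≤m+n (y ∸ s) i)) ⟨
      ∑ s ℓ + (∑ (y ∸ s) (G n (y ∸ s)) + ∑ s (λ i → G n (y ∸ s) (y ∸ s + i)))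
        ≡⟨ cong (∑ s ℓ +_) (∑-split (y ∸ s) s _) ⟨
      ∑ s ℓ + ∑ (y ∸ s + s) (G n (y ∸ s))
        ≡⟨ cong (λ z → ∑ s ℓ + ∑ z (G n (y ∸ s))) (m∸n+n≡m s≤y) ⟩
      ∑ s ℓ + size gr n (y ∸ s) ∎
      where
      open ≡-Reasoning
      full : ∀ r → r ≤ s → C r (n + s) ≡ ℓ r
      full r r≤s = cnt-all (ℓ r) (e r) _ λ p p<ℓ → s≤s (≤-trans (Filling.flag F r p p<ℓ) (+-monoʳ-≤ n r≤s))

  -- Raising the bound from `n + s` to `n + suc s` adds row `s` to the full rows, a gain of `ℓ s`,
  -- while the partition on the right edge loses one column of jumps.
  entries-high : ∀ s → s < y →
    entries y ℓ e (suc (n + s)) + ∑ n (λ j → jump gr j (y ∸ suc s)) ≡ ℓ s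
  entries-high s s<y = +-cancelˡ-≡ (∑ s ℓ + size gr n t) _ _ (begin
    ∑ s ℓ + size gr n t + (w + v)
      ≡⟨ lemma (∑ s ℓ) (size gr n t) w v ⟩
    ∑ s ℓ + (size gr n t + v) + w
      ≡⟨ cong (λ z → ∑ s ℓ + z + w) (size-column gr n t ≤-refl t<y) ⟨
    ∑ s ℓ + size gr n (suc t) + w
      ≡⟨ cong (λ z → ∑ s ℓ + size gr n z + w) (+-∸-assoc 1 s<y) ⟨
    ∑ s ℓ + size gr n (y ∸ s) + w
      ≡⟨ cong (_+ w) (rows-high s (<⇒≤ s<y)) ⟨
    ∑ y (λ r → C r (n + s)) + w
      ≡⟨ entries-atMost y ℓ e (n + s) ⟨
    ∑ y (λ r → C r (suc (n + s)))
      ≡⟨ cong (λ z → ∑ y λ r → C r z) (+-suc n s) ⟨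
    ∑ y (λ r → C r (n + suc s))
      ≡⟨ rows-high (suc s) s<y ⟩
    ∑ s ℓ + ℓ s + size gr n t
      ≡⟨ xy∙z≈xz∙y (∑ s ℓ) (ℓ s) (size gr n t) ⟩
    ∑ s ℓ + size gr n t + ℓ s ∎)
    where
    open ≡-Reasoning
    t = y ∸ suc s
    w = entries y ℓ e (suc (n + s))
    v = ∑ n (λ j → jump gr j t)
    t<y : t < y
    t<y = subst (_≤ y) (+-∸-assoc 1 s<y) (m∸n≤m y s)
    lemma : ∀ a b c d → a + b + (c + d) ≡ a + (b + d) + c
    lemma = solve-∀

-- Tableaux

entry : Tableau → ℕ → ℕ → ℕ
entry t r p = ix 0 (ix [] t r) p

FlaggedFrom⇒ix : ∀ {k r} t → FlaggedFrom k r t → ∀ i → i < length t → All (_≤ k + (r + i)) (ix [] t i)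
FlaggedFrom⇒ix {k} {r} (row ∷ t) (a , _) zero _ = subst (λ m → All (_≤ k + m) row) (sym (+-identityʳ r)) a
FlaggedFrom⇒ix {k} {r} (row ∷ t) (_ , f) (suc i) (s≤s i<) =
  subst (λ m → All (_≤ k + m) (ix [] t i)) (sym (+-suc r i)) (FlaggedFrom⇒ix t f i i<)

ix⇒FlaggedFrom : ∀ {k r} t → (∀ i → i < length t → All (_≤ k + (r + i)) (ix [] t i)) → FlaggedFrom k r t
ix⇒FlaggedFrom [] _ = tt
ix⇒FlaggedFrom {k} {r} (row ∷ t) h =
  subst (λ m → All (_≤ k + m) row) (+-identityʳ r) (h 0 z<s) ,
  ix⇒FlaggedFrom t λ i i< → subst (λ m → All (_≤ k + m) (ix [] t i)) (+-suc r i) (h (suc i) (s<s i<))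

ix-take : ∀ {X : Set} {d : X} m xs {p} → p < m → ix d (take m xs) p ≡ ix d xs p
ix-take (suc m) [] _ = refl
ix-take (suc m) (x ∷ xs) {zero} _ = refl
ix-take (suc m) (x ∷ xs) {suc p} (s≤s p<m) = ix-take m xs p<m

ColStrict⇒ix : ∀ {xs ys} → ColStrict xs ys → ∀ p → p < length ys → ix 0 xs p < ix 0 ys p
ColStrict⇒ix {xs} {ys} strict p p< = subst (_< ix 0 ys p) (ix-take (length ys) xs p<)
  (Pointwise⇒ix strict p (subst (p <_) (sym (Pointwise-length strict)) p<))

ix⇒ColStrict : ∀ xs ys → length ys ≤ length xs → (∀ p → p < length ys → ix 0 xs p < ix 0 ys p) → ColStrict xs ys
ix⇒ColStrict xs ys le h = ix⇒Pointwise _ ys len λ p p< →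
  subst (_< ix 0 ys p) (sym (ix-take (length ys) xs (subst (p <_) len p<))) (h p (subst (p <_) len p<))
  where
  len : length (take (length ys) xs) ≡ length ys
  len = trans (length-take (length ys) xs) (m≤n⇒m⊓n≡m le)

countEntry-∑ : ∀ i t → countEntry i t ≡
  ∑ (length t) (λ r → ∑ (length (ix [] t r)) λ p → bit (i ≡ᵇ entry t r p))
countEntry-∑ i [] = refl
countEntry-∑ i (row ∷ t) = begin
  boolCount (map (i ≡ᵇ_) (row ++ concat t))
    ≡⟨ cong boolCount (map-++ (i ≡ᵇ_) row (concat t)) ⟩
  boolCount (map (i ≡ᵇ_) row ++ map (i ≡ᵇ_) (concat t))
    ≡⟨ boolCount-++ (map (i ≡ᵇ_) row) _ ⟩
  boolCount (map (i ≡ᵇ_) row) + countEntry i t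
    ≡⟨ cong₂ _+_ (boolCount-map (i ≡ᵇ_) row) (countEntry-∑ i t) ⟩
  ∑ (length row) (λ p → bit (i ≡ᵇ ix 0 row p)) + _
    ≡⟨ ∑-head (length t) _ ⟨
  ∑ (suc (length t)) (λ r → ∑ (length (ix [] (row ∷ t) r)) λ p → bit (i ≡ᵇ entry (row ∷ t) r p)) ∎
  where open ≡-Reasoning

-- `lengths` can range over all `r`: past the last row `ix` returns the empty row, in accordance
-- with the vanishing of `ℓ` there.
record IsFlagged (k y : ℕ) (ℓ : ℕ → ℕ) (t : Tableau) : Set where
  field
    rows : length t ≡ y
    lengths : ∀ r → length (ix [] t r) ≡ ℓ r
    filling : Filling (suc k) ℓ (entry t)

  countEntry≡entries : ∀ i → countEntry i t ≡ entries y ℓ (entry t) i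
  countEntry≡entries i = trans (countEntry-∑ i t) (trans
    (∑-cong (length t) λ r _ → cong (λ z → ∑ z λ p → bit (i ≡ᵇ entry t r p)) (lengths r))
    (cong (λ z → ∑ z λ r → ∑ (ℓ r) λ p → bit (i ≡ᵇ entry t r p)) rows))

  bounded : ∀ {m} → k + y ≤ m → All (All (_≤ m)) t
  bounded {m} le = ix⇒All {d = []} t λ r r< → ix⇒All {d = 0} (ix [] t r) λ p p< →
    ≤-trans (Filling.flag filling r p (subst (p <_) (lengths r) p<))
      (≤-trans (≤-reflexive (sym (+-suc k r))) (≤-trans (+-monoʳ-≤ k (subst (r <_) rows r<)) le))

tabulateRows : ℕ → (ℕ → ℕ) → (ℕ → ℕ → ℕ) → Tableau
tabulateRows y ℓ e = map (λ r → map (e r) (upTo (ℓ r))) (upTo y)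

module _ {y : ℕ} {ℓ : ℕ → ℕ} (ℓ-end : ∀ r → y ≤ r → ℓ r ≡ 0) where
  private
    nonempty : ∀ {r p} → p < ℓ r → r < y
    nonempty {r} p<ℓ = ≰⇒> λ y≤r → case subst (_ <_) (ℓ-end r y≤r) p<ℓ of λ ()

    row-tabulate : ∀ e {r} → r < y → ix [] (tabulateRows y ℓ e) r ≡ map (e r) (upTo (ℓ r))
    row-tabulate e r<y = ix-map-upTo (λ r → map (e r) (upTo (ℓ r))) y r<y

  entry-tabulateRows : ∀ e {r p} → p < ℓ r → entry (tabulateRows y ℓ e) r p ≡ e r p
  entry-tabulateRows e {r} {p} p<ℓ =
    trans (cong (λ row → ix 0 row p) (row-tabulate e (nonempty p<ℓ))) (ix-map-upTo (e r) (ℓ r) p<ℓ)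

  tabulateRows-IsFlagged : (∀ r → ℓ (suc r) ≤ ℓ r) → ∀ {k e} → Filling (suc k) ℓ e → IsFlagged k y ℓ (tabulateRows y ℓ e)
  tabulateRows-IsFlagged ℓ-antitone {k} {e} F = record
    { rows = length-map-upTo _ y
    ; lengths = lengths'
    ; filling = record
      { positive = λ r p p<ℓ → subst (1 ≤_) (sym (same p<ℓ)) (positive r p p<ℓ)
      ; weak = λ r p q p≤q q<ℓ → subst₂ _≤_ (sym (same (≤-<-trans p≤q q<ℓ))) (sym (same q<ℓ)) (weak r p q p≤q q<ℓ)
      ; strict = λ r p p<ℓ → subst₂ _<_ (sym (same (<-≤-trans p<ℓ (ℓ-antitone r)))) (sym (same p<ℓ)) (strict r p p<ℓ)
      ; flag = λ r p p<ℓ → subst (_≤ suc k + r) (sym (same p<ℓ)) (flag r p p<ℓ) } }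
    where
    open Filling F
    same : ∀ {r p} → p < ℓ r → entry (tabulateRows y ℓ e) r p ≡ e r p
    same = entry-tabulateRows e
    lengths' : ∀ r → length (ix [] (tabulateRows y ℓ e) r) ≡ ℓ r
    lengths' r with <-≤-connex r y
    ... | inj₁ r<y = trans (cong length (row-tabulate e r<y)) (length-map-upTo (e r) (ℓ r))
    ... | inj₂ y≤r = trans (cong length (ix-beyond (tabulateRows y ℓ e) (subst (_≤ r) (sym (length-map-upTo _ y)) y≤r)))
                           (sym (ℓ-end r y≤r))

module _ {k y : ℕ} {ℓ : ℕ → ℕ} (shape : List ℕ) (length-shape : length shape ≡ y)
  (shape-ℓ : ∀ r → ix 0 shape r ≡ ℓ r) where

  private
    ℓ-end : ∀ r → y ≤ r → ℓ r ≡ 0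
    ℓ-end r y≤r = trans (sym (shape-ℓ r)) (ix-beyond shape (subst (_≤ r) (sym length-shape) y≤r))

    nonempty : ∀ {r p} → p < ℓ r → r < y
    nonempty {r} p<ℓ = ≰⇒> λ y≤r → case subst (_ <_) (ℓ-end r y≤r) p<ℓ of λ ()

  SSYT⇒IsFlagged : ∀ {t} → IsSSYT shape t → Flagged k t → IsFlagged k y ℓ t
  SSYT⇒IsFlagged {t} (shaped , pos , weak , strict) flagged = record
    { rows = rows'
    ; lengths = lengths'
    ; filling = record
      { positive = λ r p p<ℓ → All⇒ix (All⇒ix pos r (r< p<ℓ)) p (p< p<ℓ)
      ; weak = weak'
      ; strict = λ r p p<ℓ → ColStrict⇒ix (Linked⇒ix strict r (r< p<ℓ)) p (p< p<ℓ)
      ; flag = λ r p p<ℓ → subst (entry t r p ≤_) (+-suc k r)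
          (All⇒ix (FlaggedFrom⇒ix t flagged r (r< p<ℓ)) p (p< p<ℓ)) } }
    where
    rows' : length t ≡ y
    rows' = trans (Pointwise-length shaped) length-shape
    lengths' : ∀ r → length (ix [] t r) ≡ ℓ r
    lengths' r with <-≤-connex r (length t)
    ... | inj₁ r<t = trans (Pointwise⇒ix {d = []} {e = 0} shaped r r<t) (shape-ℓ r)
    ... | inj₂ t≤r = trans (cong length (ix-beyond t t≤r)) (sym (ℓ-end r (subst (_≤ r) rows' t≤r)))
    r< : ∀ {r p} → p < ℓ r → r < length t
    r< p<ℓ = subst (_ <_) (sym rows') (nonempty p<ℓ)
    p< : ∀ {r p} → p < ℓ r → p < length (ix [] t r)
    p< {r} p<ℓ = subst (_ <_) (sym (lengths' r)) p<ℓ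
    weak' : ∀ r → Sorted (ℓ r) (entry t r)
    weak' r p q p≤q q<ℓ =
      Linked⇒Sorted (All⇒ix {d = []} weak r (r< q<ℓ)) p q p≤q (p< q<ℓ)

  IsFlagged⇒SSYT : (∀ r → ℓ (suc r) ≤ ℓ r) → ∀ {t} → IsFlagged k y ℓ t → IsSSYT shape t × Flagged k t
  IsFlagged⇒SSYT ℓ-antitone {t} is =
    ( ix⇒Pointwise {d = []} {e = 0} t shape (trans rows (sym length-shape)) (λ r _ → trans (lengths r) (sym (shape-ℓ r)))
    , ix⇒All {d = []} t (λ r _ → ix⇒All {d = 0} _ λ p p< → positive r p (ℓ> r p<))
    , ix⇒All {d = []} t (λ r _ → Sorted⇒Linked _ (subst (λ z → Sorted z (entry t r)) (sym (lengths r)) (weak r)))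
    , ix⇒Linked {d = []} t (λ r _ → ix⇒ColStrict _ _
        (subst₂ _≤_ (sym (lengths (suc r))) (sym (lengths r)) (ℓ-antitone r))
        (λ p p< → strict r p (ℓ> (suc r) p<))) )
    , ix⇒FlaggedFrom t λ r _ → ix⇒All {d = 0} _ λ p p< →
        subst (entry t r p ≤_) (sym (+-suc k r)) (flag r p (ℓ> r p<))
    where
    open IsFlagged is
    open Filling filling
    ℓ> : ∀ r {p} → p < length (ix [] t r) → p < ℓ r
    ℓ> r = subst (_ <_) (lengths r)

IsFlagged-unique : ∀ {k y ℓ t t'} → IsFlagged k y ℓ t → IsFlagged k y ℓ t' →
  (∀ r → r < y → ∀ m → m ≤ suc k + r → atMost ℓ (entry t) r m ≡ atMost ℓ (entry t') r m) → t ≡ t'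
IsFlagged-unique {k} {y} {ℓ} {t} {t'} is is' eq = ix-ext {d = []} t t' (trans I.rows (sym I'.rows)) λ r r< →
  ix-ext {d = 0} _ _ (trans (I.lengths r) (sym (I'.lengths r))) λ p p< →
    cnt-injective (F.weak r) (F'.weak r) (suc k + r) (F.flag r) (F'.flag r)
      (counts r (subst (r <_) I.rows r<)) p (subst (p <_) (I.lengths r) p<)
  where
  module I = IsFlagged is
  module I' = IsFlagged is'
  module F = Filling I.filling
  module F' = Filling I'.filling
  counts : ∀ r → r < y → ∀ s → s ≤ suc k + r → cnt (ℓ r) (entry t r) s ≡ cnt (ℓ r) (entry t' r) s
  counts r r<y zero _ = ∑-cong (ℓ r) λ _ _ → refl
  counts r r<y (suc m) m< = eq r r<y m (<⇒≤ m<)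

-- Path tuples

height : Path → ℕ → ℕ
height P = ix 0 (eastHeights P)

ix-++ˡ : ∀ {X : Set} {d : X} xs ys {p} → p < length xs → ix d (xs ++ ys) p ≡ ix d xs p
ix-++ˡ (x ∷ xs) ys {zero} _ = refl
ix-++ˡ (x ∷ xs) ys {suc p} (s≤s p<) = ix-++ˡ xs ys p<

ix-last : ∀ {X : Set} {d : X} xs z → ix d (xs ++ z ∷ []) (length xs) ≡ z
ix-last [] z = refl
ix-last (x ∷ xs) z = ix-last xs z

ix-map : ∀ {X Y : Set} {d : X} (f : X → Y) xs p → ix (f d) (map f xs) p ≡ f (ix d xs p)
ix-map f [] p = refl
ix-map f (x ∷ xs) zero = refl
ix-map f (x ∷ xs) (suc p) = ix-map f xs p

module _ {x y} P (to : PathTo x y P) where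
  length-eastHeights : length (eastHeights P) ≡ x
  length-eastHeights = trans (length-eastHeightsFrom 0 P) (proj₁ to)

  height-sorted : Sorted x (height P)
  height-sorted = subst (λ z → Sorted z (height P)) length-eastHeights (Linked⇒Sorted (eastHeightsFrom-linked 0 P))

  height-≤ : ∀ p → p < x → height P p ≤ y
  height-≤ p p<x = subst (height P p ≤_) (proj₂ to)
    (All⇒ix (eastHeightsFrom-≤ 0 P) p (subst (p <_) (sym length-eastHeights) p<x))

module _ {x y} P Q (toP : PathTo x y P) (toQ : PathTo x y Q) where
  WeaklyAbove⇒ix : WeaklyAbove P Q → ∀ p → p < x → height Q p ≤ height P p
  WeaklyAbove⇒ix above p p<x = Pointwise⇒ix above p (subst (p <_) (sym (length-eastHeights P toP)) p<x)

  ix⇒WeaklyAbove : (∀ p → p < x → height Q p ≤ height P p) → WeaklyAbove P Q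
  ix⇒WeaklyAbove h = ix⇒Pointwise _ _ (trans (length-eastHeights P toP) (sym (length-eastHeights Q toQ)))
    λ p p< → h p (subst (p <_) (length-eastHeights P toP) p<)

  height-injective : (∀ p → p < x → height P p ≡ height Q p) → P ≡ Q
  height-injective h = eastHeightsFrom-injective 0 P Q
    (ix-ext {d = 0} _ _ (trans (length-eastHeights P toP) (sym (length-eastHeights Q toQ)))
      λ p p< → h p (subst (p <_) (length-eastHeights P toP) p<))
    (trans (proj₂ toP) (sym (proj₂ toQ)))

  coincide-∑ : coincide P Q ≡ ∑ x (λ p → bit (height P p ≡ᵇ height Q p))
  coincide-∑ = trans
    (boolCount-zipWith _≡ᵇ_ (eastHeights P) (eastHeights Q) (trans (length-eastHeights P toP) (sym (length-eastHeights Q toQ))))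
    (cong (λ z → ∑ z λ p → bit (height P p ≡ᵇ height Q p)) (length-eastHeights P toP))

data Position (k : ℕ) : ℕ → Set where
  initial : Position k 0
  inner : ∀ {i} → i < k → Position k (suc i)
  final : Position k (suc k)

position : ∀ {k} j → j ≤ suc k → Position k j
position zero _ = initial
position (suc i) (s≤s i≤k) with m≤n⇒m<n∨m≡n i≤k
... | inj₁ i<k = inner i<k
... | inj₂ refl = final

module _ {k : ℕ} (x y : ℕ) (B : Path) (Ps : Vec Path k) where
  line : List Path
  line = topPath x y ∷ toList Ps ++ B ∷ []

  strand : ℕ → Path
  strand = ix [] line

  record System : Set where
    field
      paths : ∀ j → j ≤ suc k → PathTo x y (strand j)
      descends : ∀ j → j < suc k → ∀ p → p < x → height (strand (suc j)) p ≤ height (strand j) p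

    antitone : ∀ {i j} → i ≤ j → j ≤ suc k → ∀ p → p < x → height (strand j) p ≤ height (strand i) p
    antitone {i} {j} i≤j = go (≤⇒≤′ i≤j)
      where
      go : ∀ {i j} → i ≤′ j → j ≤ suc k → ∀ p → p < x → height (strand j) p ≤ height (strand i) p
      go (≤′-reflexive refl) _ p p<x = ≤-refl
      go (≤′-step {j} i≤j) j<n p p<x = ≤-trans (descends j j<n p p<x) (go i≤j (<⇒≤ j<n) p p<x)

  strand-inner : ∀ i → i < k → strand (suc i) ≡ ix [] (toList Ps) i
  strand-inner i i<k = ix-++ˡ (toList Ps) _ (subst (i <_) (sym (length-toList Ps)) i<k)

  strand-last : strand (suc k) ≡ B
  strand-last = trans (cong (ix [] (toList Ps ++ B ∷ [])) (sym (length-toList Ps))) (ix-last (toList Ps) B)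

  length-line : length (toList Ps ++ B ∷ []) ≡ suc k
  length-line = trans (length-++ (toList Ps)) (trans (cong (_+ 1) (length-toList Ps)) (+-comm k 1))

  -- The links to the two ends of the line come from the bounds on the first and the last path,
  -- which exist because `1 ≤ k`.
  InPk⇒System : 1 ≤ k → PathTo x y B → InPk x y k (topPath x y) B Ps → System
  InPk⇒System 1≤k toB (all , linked) = record
    { paths = paths'
    ; descends = λ j j<n → WeaklyAbove⇒ix (strand j) (strand (suc j)) (paths' j (<⇒≤ j<n)) (paths' (suc j) j<n) (chain j j<n) }
    where
    lookup : ∀ {Q : Path → Set} → All Q (toList Ps) → ∀ i → i < k → Q (strand (suc i))
    lookup {Q} qs i i<k = subst Q (sym (strand-inner i i<k)) (All⇒ix qs i (subst (i <_) (sym (length-toList Ps)) i<k))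
    paths' : ∀ j → j ≤ suc k → PathTo x y (strand j)
    paths' j j≤n with position j j≤n
    ... | initial = topPath-to x y
    ... | inner i<k = proj₁ (lookup all _ i<k)
    ... | final = subst (PathTo x y) (sym strand-last) toB
    chain : ∀ j → j < suc k → WeaklyAbove (strand j) (strand (suc j))
    chain zero _ = proj₂ (proj₂ (lookup all 0 1≤k))
    chain (suc i) (s≤s i<k) with m≤n⇒m<n∨m≡n i<k
    ... | inj₁ 1+i<k = subst₂ WeaklyAbove (sym (strand-inner i i<k)) (sym (strand-inner (suc i) 1+i<k))
            (Linked⇒ix linked i (subst (suc i <_) (sym (length-toList Ps)) 1+i<k))
    ... | inj₂ refl = subst (WeaklyAbove (strand (suc i))) (sym strand-last) (proj₁ (proj₂ (lookup all i i<k)))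

  System⇒InPk : System → InPk x y k (topPath x y) B Ps
  System⇒InPk sys =
    ix⇒All {d = []} (toList Ps) (λ i i< → inP i (subst (i <_) (length-toList Ps) i<)) ,
    ix⇒Linked {d = []} (toList Ps) λ i i< → below i (subst (suc i <_) (length-toList Ps) i<)
    where
    open System sys
    above : ∀ {i j} → i ≤ j → j ≤ suc k → WeaklyAbove (strand i) (strand j)
    above {i} {j} i≤j j≤n = ix⇒WeaklyAbove (strand i) (strand j) (paths _ (≤-trans i≤j j≤n)) (paths _ j≤n) (antitone i≤j j≤n)
    inP : ∀ i → i < k → InP x y (topPath x y) B (ix [] (toList Ps) i)
    inP i i<k rewrite sym (strand-inner i i<k) =
      paths (suc i) 1+i≤n , subst (WeaklyAbove (strand (suc i))) strand-last (above 1+i≤n ≤-refl) , above z≤n 1+i≤n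
      where 1+i≤n = m<n⇒m<1+n i<k
    below : ∀ i → suc i < k → WeaklyAbove (ix [] (toList Ps) i) (ix [] (toList Ps) (suc i))
    below i 1+i<k rewrite sym (strand-inner i (<⇒≤ 1+i<k)) | sym (strand-inner (suc i) 1+i<k) =
      above (n≤1+n (suc i)) (m<n⇒m<1+n 1+i<k)

  levels : ℕ → ℕ → ℕ
  levels j t = cnt x (height (strand j)) t

  module _ (sys : System) where
    open System sys

    levels-top : ∀ t → t ≤ y → levels 0 t ≡ 0
    levels-top t t≤y = cnt-none x (height (topPath x y)) t λ p p<x → subst (t ≤_) (sym (ix-topPath x y p<x)) t≤y

    system-growth : Growth (suc k) y (forward levels)
    system-growth = forward-growth levels-top
      (λ j _ → cnt-none x (height (strand j)) 0 λ _ _ → z≤n)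
      (λ j t j<n _ → cnt-mono x {height (strand j)} {height (strand (suc j))} {t} λ p p<x → ≤-<-trans (descends j j<n p p<x))
      (λ j t _ _ → cnt-monoʳ x _ (n≤1+n t))

    -- The statistics are computed from any diagram with these first parts, since a diagram may
    -- equally come from a tableau by the backward rule.
    module _ {G : ℕ → ℕ → ℕ → ℕ} (gr : Growth (suc k) y G)
      (match : ∀ j t → j ≤ suc k → t ≤ y → G j t 0 ≡ levels j t) where

      private
        jump-levels : ∀ j t → j < suc k → t < y →
          levels (suc j) (suc t) ≡ (levels (suc j) t ⊔ levels j (suc t)) + jump gr j t
        jump-levels j t j<n t<y = trans (sym (match (suc j) (suc t) j<n t<y)) (trans (jump-spec gr j t j<n t<y)
          (cong (_+ jump gr j t) (cong₂ _⊔_ (match (suc j) t j<n (<⇒≤ t<y)) (match j (suc t) (<⇒≤ j<n) t<y))))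

      jumps+coincide : ∀ j → j < suc k → ∑ y (jump gr j) + coincide (strand j) (strand (suc j)) ≡ x
      jumps+coincide j j<n = +-cancelˡ-≡ (∑ y maxes) _ _ (begin
        ∑ y maxes + (∑ y (jump gr j) + coincide (strand j) (strand (suc j)))
          ≡⟨ +-assoc (∑ y maxes) _ _ ⟨
        ∑ y maxes + ∑ y (jump gr j) + coincide (strand j) (strand (suc j))
          ≡⟨ cong₂ _+_ (sym (∑-distrib-+ y maxes (jump gr j))) (coincide-∑ (strand j) (strand (suc j)) toA toB) ⟩
        ∑ y (λ t → maxes t + jump gr j t) + _
          ≡⟨ cong (_+ _) (∑-cong y λ t t<y → sym (jump-levels j t j<n t<y)) ⟩
        ∑ y (λ t → levels (suc j) (suc t)) + _
          ≡⟨ coincide-count (height-sorted (strand j) toA) (height-sorted (strand (suc j)) toB) (descends j j<n) (height-≤ (strand j) toA) ⟩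
        ∑ y maxes + x ∎)
        where
        open ≡-Reasoning
        maxes = λ t → levels (suc j) t ⊔ levels j (suc t)
        toA = paths j (<⇒≤ j<n)
        toB = paths (suc j) j<n

      private
        -- In a fixed column the heights along `line` form a descending sequence, to which
        -- `straddle` applies.
        unused-pointwise : ∀ t p → t < y → p < x →
          bit ((nth (eastHeights B) p <ᵇ t) ∧ (t <ᵇ nth (eastHeights (topPath x y)) p)
                ∧ not (anyB (map (λ P → nth (eastHeights P) p ≡ᵇ t) (toList Ps))))
            + ∑ (suc k) (λ j → lt (height (strand j) p) (suc t))
          ≡ ∑ (suc k) (λ j → lt (height (strand (suc j)) p) t ⊔ lt (height (strand j) p) (suc t))
        unused-pointwise t p t<y p<x = begin
          _ ≡⟨ cong₂ (λ c bs → bit (c ∧ (t <ᵇ nth (eastHeights (topPath x y)) p) ∧ not (anyB bs))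
                                + ∑ (suc k) (λ j → lt (height (strand j) p) (suc t)))
                (cong (_<ᵇ t) (nth≡ix (eastHeights B) p))
                (trans (map-cong (λ P → cong (_≡ᵇ t) (nth≡ix (eastHeights P) p)) (toList Ps))
                       (map-∘ {g = _≡ᵇ t} {f = λ P → height P p} (toList Ps))) ⟩
          bit ((height B p <ᵇ t) ∧ (t <ᵇ nth (eastHeights (topPath x y)) p) ∧ not (anyB (map (_≡ᵇ t) vs)))
            + ∑ (suc k) (λ j → lt (height (strand j) p) (suc t))
            ≡⟨ cong₂ (λ c z → bit ((height B p <ᵇ t) ∧ c ∧ not (anyB (map (_≡ᵇ t) vs))) + z)
                 (<ᵇ-yes (subst (t <_) (sym (nth≡ix (eastHeights (topPath x y)) p)) t<top))
                 (∑-cong (suc k) λ j _ → cong (λ z → lt z (suc t)) (sym (values j))) ⟩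
          bit ((height B p <ᵇ t) ∧ not (anyB (map (_≡ᵇ t) vs)))
            + ∑ (suc k) (λ j → lt (a j) (suc t))
            ≡⟨ subst (λ n → bit ((height B p <ᵇ t) ∧ not (anyB (map (_≡ᵇ t) vs))) + ∑ (suc n) (λ j → lt (a j) (suc t))
                              ≡ ∑ (suc n) (λ j → lt (a (suc j)) t ⊔ lt (a j) (suc t)))
                 (trans (length-map _ (toList Ps)) (length-toList Ps))
                 (straddle t (height (topPath x y) p) vs (height B p) t<top chain) ⟩
          ∑ (suc k) (λ j → lt (a (suc j)) t ⊔ lt (a j) (suc t))
            ≡⟨ ∑-cong (suc k) (λ j _ → cong₂ (λ z w → lt z t ⊔ lt w (suc t)) (values (suc j)) (values j)) ⟩
          _ ∎
          where
          open ≡-Reasoning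
          vs = map (λ P → height P p) (toList Ps)
          a = ix 0 (height (topPath x y) p ∷ vs ++ height B p ∷ [])
          t<top : t < height (topPath x y) p
          t<top = subst (t <_) (sym (ix-topPath x y p<x)) t<y
          line-values : map (λ P → height P p) line ≡ height (topPath x y) p ∷ vs ++ height B p ∷ []
          line-values = cong (height (topPath x y) p ∷_) (map-++ (λ P → height P p) (toList Ps) (B ∷ []))
          values : ∀ j → a j ≡ height (strand j) p
          values j = trans (cong (λ l → ix 0 l j) (sym line-values)) (ix-map (λ P → height P p) line j)
          chain : Linked _≥_ (height (topPath x y) p ∷ vs ++ height B p ∷ [])
          chain = ix⇒Linked {d = 0} _ λ j j< → subst₂ _≥_ (sym (values j)) (sym (values (suc j)))
            (descends j (≤-pred (subst (suc j <_) len j<)) p p<x)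
            where
            len : length (height (topPath x y) p ∷ vs ++ height B p ∷ []) ≡ suc (suc k)
            len = trans (cong length (sym line-values)) (trans (length-map _ line) (cong suc length-line))

      unused+jumps : ∀ t → t < y →
        unusedAt x (topPath x y) B (toList Ps) t + ∑ (suc k) (λ j → jump gr j t) ≡ levels (suc k) (suc t)
      unused+jumps t t<y = +-cancelˡ-≡ (∑ n lower) _ _ (begin
        ∑ n lower + (U + ∑ n (λ j → jump gr j t))
          ≡⟨ +-assoc (∑ n lower) _ _ ⟨
        ∑ n lower + U + ∑ n (λ j → jump gr j t)
          ≡⟨ cong (_+ ∑ n (λ j → jump gr j t)) (trans (+-comm (∑ n lower) U) unused) ⟩
        ∑ n maxes + ∑ n (λ j → jump gr j t)
          ≡⟨ ∑-distrib-+ n _ _ ⟨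
        ∑ n (λ j → maxes j + jump gr j t)
          ≡⟨ ∑-cong n (λ j j<n → sym (jump-levels j t j<n t<y)) ⟩
        ∑ n (lower ∘ suc)
          ≡⟨ trans (cong (∑ n (lower ∘ suc) +_) (levels-top (suc t) t<y)) (+-identityʳ _) ⟨
        ∑ n (lower ∘ suc) + lower 0
          ≡⟨ ∑-shift n lower ⟩
        ∑ n lower + levels n (suc t) ∎)
        where
        open ≡-Reasoning
        n = suc k
        U = unusedAt x (topPath x y) B (toList Ps) t
        lower = λ j → levels j (suc t)
        maxes = λ j → levels (suc j) t ⊔ levels j (suc t)
        unused : U + ∑ n lower ≡ ∑ n maxes
        unused = begin
          U + ∑ n lower
            ≡⟨ cong₂ _+_ (boolCount-upTo _ x) (∑-swap n x λ j p → lt (height (strand j) p) (suc t)) ⟩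
          ∑ x _ + ∑ x (λ p → ∑ n (λ j → lt (height (strand j) p) (suc t)))
            ≡⟨ ∑-distrib-+ x _ _ ⟨
          ∑ x _
            ≡⟨ ∑-cong x (λ p p<x → unused-pointwise t p t<y p<x) ⟩
          ∑ x (λ p → ∑ n (λ j → lt (height (strand (suc j)) p) t ⊔ lt (height (strand j) p) (suc t)))
            ≡⟨ ∑-swap x n _ ⟩
          ∑ n (λ j → ∑ x (λ p → lt (height (strand (suc j)) p) t ⊔ lt (height (strand j) p) (suc t)))
            ≡⟨ ∑-cong n (λ j j<n → cnt-⊔ (height-sorted (strand (suc j)) (paths (suc j) j<n)) (height-sorted (strand j) (paths j (<⇒≤ j<n))) t (suc t)) ⟨
          ∑ n maxes ∎

-- From a diagram to a path tuple

pathOf : ℕ → ℕ → (ℕ → ℕ) → Path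
pathOf x y a = pathFrom y 0 (map a (upTo x))

module _ {x y a} (sorted : Sorted x a) (bound : ∀ p → p < x → a p ≤ y) where
  private
    as = map a (upTo x)
    length-as : length as ≡ x
    length-as = length-map-upTo a x
    ix-as : ∀ {p} → p < x → ix 0 as p ≡ a p
    ix-as = ix-map-upTo a x
    linked : Linked _≤_ (0 ∷ as)
    linked = Sorted⇒Linked (0 ∷ as) λ where
      zero _ _ _ → z≤n
      (suc p) (suc q) (s≤s p≤q) (s≤s q<) → let q<x = subst (q <_) length-as q< in
        subst₂ _≤_ (sym (ix-as (≤-<-trans p≤q q<x))) (sym (ix-as q<x)) (sorted p q p≤q q<x)
    heights : eastHeights (pathOf x y a) ≡ as
    heights = eastHeights-pathFrom y 0 as linked

  pathOf-to : PathTo x y (pathOf x y a)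
  pathOf-to =
    trans (sym (length-eastHeightsFrom 0 (pathOf x y a))) (trans (cong length heights) length-as) ,
    countN-pathFrom y 0 as linked (z≤n ∷ ix⇒All {d = 0} as λ p p< →
      let p<x = subst (p <_) length-as p< in subst (_≤ y) (sym (ix-as p<x)) (bound p p<x))

  height-pathOf : ∀ p → p < x → height (pathOf x y a) p ≡ a p
  height-pathOf p p<x = trans (cong (λ hs → ix 0 hs p) heights) (ix-as p<x)

sequence : {X : Set} (k : ℕ) → (ℕ → X) → Vec X k
sequence zero f = []
sequence (suc k) f = f 0 ∷ sequence k (f ∘ suc)

toList-sequence : ∀ {X : Set} k (f : ℕ → X) → toList (sequence k f) ≡ applyUpTo f k
toList-sequence zero f = refl
toList-sequence (suc k) f = cong (f 0 ∷_) (toList-sequence k (f ∘ suc))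

module _ {k x y : ℕ} (B : Path) (toB : PathTo x y B) {G : ℕ → ℕ → ℕ → ℕ} (gr : Growth (suc k) y G)
  (edge : ∀ t → t ≤ y → G (suc k) t 0 ≡ cnt x (height B) t) where
  open Growth gr

  private
    G-mono : ∀ {i j} → i ≤′ j → j ≤ suc k → ∀ t → t ≤ y → G i t 0 ≤ G j t 0
    G-mono (≤′-reflexive refl) _ t t≤y = ≤-refl
    G-mono (≤′-step {j} i≤j) j<n t t≤y = ≤-trans (G-mono i≤j (<⇒≤ j<n) t t≤y) (proj₁ (hor j t j<n t≤y 0))

    G≤x : ∀ j → j ≤ suc k → ∀ t → t ≤ y → G j t 0 ≤ x
    G≤x j j≤n t t≤y = ≤-trans (G-mono (≤⇒≤′ j≤n) ≤-refl t t≤y)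
      (subst (_≤ x) (sym (edge t t≤y)) (cnt-≤ x (height B) t))

    -- Shifted by one because threshold 0 counts no column; `conj` then has one value for each of
    -- the thresholds from 1 to `y`.
    rises : ℕ → ℕ → ℕ
    rises j t = G j (suc t) 0

    value : ℕ → ℕ → ℕ
    value j = conj y (rises j)

    value-sorted : ∀ j → Sorted x (value j)
    value-sorted j = conj-sorted y (rises j) x

    value≤ : ∀ j p → p < x → value j p ≤ y
    value≤ j p _ = cnt-≤ y (rises j) (suc p)

    value-count : ∀ j → j ≤ suc k → ∀ t → t ≤ y → cnt x (value j) t ≡ G j t 0
    value-count j j≤n zero _ = trans (cnt-none x (value j) 0 λ _ _ → z≤n) (sym (bottom j j≤n 0))
    value-count j j≤n (suc t) t<y =
      cnt-conj {y} (sorted-from-steps λ s s<y → proj₁ (ver j (suc s) j≤n s<y 0)) x t<y (G≤x j j≤n (suc t) t<y)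

    -- Only the inner paths are built from their heights. The outer sequences must be recognised as
    -- `T`, by the vanishing left edge, and as `B`, by `edge`.
    value-top : ∀ p → p < x → value 0 p ≡ y
    value-top = cnt-injective {x} {value 0} {λ _ → y} (value-sorted 0) (λ _ _ _ _ → ≤-refl) y (value≤ 0) (λ _ _ → ≤-refl)
      λ t t≤y → trans (value-count 0 z≤n t t≤y) (trans (left t t≤y 0) (sym (cnt-none x (λ _ → y) t λ _ _ → t≤y)))

    value-bottom : ∀ p → p < x → value (suc k) p ≡ height B p
    value-bottom = cnt-injective (value-sorted (suc k)) (height-sorted B toB) y (value≤ (suc k)) (height-≤ B toB)
      λ t t≤y → trans (value-count (suc k) ≤-refl t t≤y) (edge t t≤y)

    value-descends : ∀ j → j < suc k → ∀ p → value (suc j) p ≤ value j p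
    value-descends j j<n p = cnt-mono y {rises (suc j)} {rises j} {suc p} λ t t<y →
      ≤-<-trans (proj₁ (hor j (suc t) j<n t<y 0))

  diagram-paths : Vec Path k
  diagram-paths = sequence k λ i → pathOf x y (value (suc i))

  private
    strand' : ℕ → Path
    strand' = strand x y B diagram-paths

    strand-sequence : ∀ i → i < k → strand' (suc i) ≡ pathOf x y (value (suc i))
    strand-sequence i i<k = trans (strand-inner x y B diagram-paths i i<k)
      (trans (cong (λ l → ix [] l i) (toList-sequence k _)) (ix-applyUpTo _ k i<k))

    strand-to : ∀ j → j ≤ suc k → PathTo x y (strand' j)
    strand-to j j≤n with position j j≤n
    ... | initial = topPath-to x y
    ... | inner {i} i<k = subst (PathTo x y) (sym (strand-sequence i i<k)) (pathOf-to (value-sorted (suc i)) (value≤ (suc i)))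
    ... | final = subst (PathTo x y) (sym (strand-last x y B diagram-paths)) toB

    strand-height : ∀ j → j ≤ suc k → ∀ p → p < x → height (strand' j) p ≡ value j p
    strand-height j j≤n p p<x with position j j≤n
    ... | initial = trans (ix-topPath x y p<x) (sym (value-top p p<x))
    ... | inner {i} i<k = trans (cong (λ P → height P p) (strand-sequence i i<k))
            (height-pathOf (value-sorted (suc i)) (value≤ (suc i)) p p<x)
    ... | final = trans (cong (λ P → height P p) (strand-last x y B diagram-paths)) (sym (value-bottom p p<x))

  diagram-system : System x y B diagram-paths
  diagram-system = record
    { paths = strand-to
    ; descends = λ j j<n p p<x → subst₂ _≤_ (sym (strand-height (suc j) j<n p p<x))
        (sym (strand-height j (<⇒≤ j<n) p p<x)) (value-descends j j<n p) }

  diagram-levels : ∀ j t → j ≤ suc k → t ≤ y → G j t 0 ≡ levels x y B diagram-paths j t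
  diagram-levels j t j≤n t≤y = trans (sym (value-count j j≤n t t≤y))
    (∑-cong x λ p p<x → cong (λ z → lt z t) (sym (strand-height j j≤n p p<x)))

System-unique : ∀ {k x y B} {Ps Qs : Vec Path k} → System x y B Ps → System x y B Qs →
  (∀ j t → j ≤ suc k → t ≤ y → levels x y B Ps j t ≡ levels x y B Qs j t) → Ps ≡ Qs
System-unique {k} {x} {y} {B} {Ps} {Qs} sys sys' eq = trans (sym (cast-is-id refl Ps)) (toList-injective refl Ps Qs
  (ix-ext {d = []} (toList Ps) (toList Qs) (trans (length-toList Ps) (sym (length-toList Qs))) λ i i< →
    let i<k = subst (i <_) (length-toList Ps) i< in
    trans (sym (strand-inner x y B Ps i i<k)) (trans (same (suc i) (m<n⇒m<1+n i<k)) (strand-inner x y B Qs i i<k))))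
  where
  module S = System sys
  module S' = System sys'
  same : ∀ j → j ≤ suc k → strand x y B Ps j ≡ strand x y B Qs j
  same j j≤n = height-injective P Q toP toQ
    (cnt-injective (height-sorted P toP) (height-sorted Q toQ) y (height-≤ P toP) (height-≤ Q toQ) λ t t≤y → eq j t j≤n t≤y)
    where
    P = strand x y B Ps j
    Q = strand x y B Qs j
    toP = S.paths j j≤n
    toQ = S'.paths j j≤n

-- The bijection

ix-++ʳ : ∀ {X : Set} {d : X} xs ys p → ix d (xs ++ ys) (length xs + p) ≡ ix d ys p
ix-++ʳ [] ys p = refl
ix-++ʳ (x ∷ xs) ys p = ix-++ʳ xs ys p

++-injective : ∀ {X : Set} {us vs us' vs' : List X} → length us ≡ length us' →
  us ++ vs ≡ us' ++ vs' → us ≡ us' × vs ≡ vs'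
++-injective {us = []} {us' = []} _ eq = refl , eq
++-injective {us = u ∷ us} {us' = u' ∷ us'} len eq with ++-injective {us = us} (suc-injective len) (∷-injectiveʳ eq)
... | eqs , eqs' = cong₂ _∷_ (∷-injectiveˡ eq) eqs , eqs'

length-consecCoincide : ∀ P Qs → length (consecCoincide (P ∷ Qs)) ≡ length Qs
length-consecCoincide P [] = refl
length-consecCoincide P (Q ∷ Qs) = cong suc (length-consecCoincide Q Qs)

ix-consecCoincide : ∀ P Qs j → j < length Qs →
  ix 0 (consecCoincide (P ∷ Qs)) j ≡ coincide (ix [] (P ∷ Qs) j) (ix [] (P ∷ Qs) (suc j))
ix-consecCoincide P (Q ∷ Qs) zero _ = refl
ix-consecCoincide P (Q ∷ Qs) (suc j) (s≤s j<) = ix-consecCoincide Q Qs j j<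

-- Uniqueness of proofs of the side conditions

×-irrelevant : ∀ {X Y : Set} → Irrelevant X → Irrelevant Y → Irrelevant (X × Y)
×-irrelevant irrX irrY (x , y) (x' , y') = cong₂ _,_ (irrX x x') (irrY y y')

WeaklyAbove-irrelevant : ∀ {P Q} → Irrelevant (WeaklyAbove P Q)
WeaklyAbove-irrelevant = Pointwise.irrelevant ≤-irrelevant

InPk-irrelevant : ∀ {x y k T B Ps} → Irrelevant (InPk x y k T B Ps)
InPk-irrelevant {T = T} {B} = ×-irrelevant
  (All.irrelevant λ {P} → ×-irrelevant (×-irrelevant ≡-irrelevant ≡-irrelevant)
    (×-irrelevant (WeaklyAbove-irrelevant {P} {B}) (WeaklyAbove-irrelevant {T} {P})))
  (Linked.irrelevant λ {P} {Q} → WeaklyAbove-irrelevant {P} {Q})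

IsSSYT-irrelevant : ∀ {λs t} → Irrelevant (IsSSYT λs t)
IsSSYT-irrelevant = ×-irrelevant (Pointwise.irrelevant ≡-irrelevant)
  (×-irrelevant (All.irrelevant (All.irrelevant ≤-irrelevant))
    (×-irrelevant (All.irrelevant (Linked.irrelevant ≤-irrelevant))
      (Linked.irrelevant (Pointwise.irrelevant ≤-irrelevant))))

FlaggedFrom-irrelevant : ∀ {k r} t → Irrelevant (FlaggedFrom k r t)
FlaggedFrom-irrelevant [] _ _ = refl
FlaggedFrom-irrelevant (row ∷ t) = ×-irrelevant (All.irrelevant ≤-irrelevant) (FlaggedFrom-irrelevant t)

HasWeight-irrelevant : ∀ {w t} → Irrelevant (HasWeight w t)
HasWeight-irrelevant = ×-irrelevant ≡-irrelevant (All.irrelevant (All.irrelevant ≤-irrelevant))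

module _ (k x y : ℕ) (B : Path) (toB : PathTo x y B) where
  private
    n = suc k
    T = topPath x y
    shape = shapeTB x y T B

    ℓ : ℕ → ℕ
    ℓ r = cnt x (height B) (y ∸ r)

    ℓ-antitone : ∀ r → ℓ (suc r) ≤ ℓ r
    ℓ-antitone r = cnt-monoʳ x (height B) (∸-monoʳ-≤ y (n≤1+n r))

    ℓ-end : ∀ r → y ≤ r → ℓ r ≡ 0
    ℓ-end r y≤r rewrite m≤n⇒m∸n≡0 y≤r = cnt-none x (height B) 0 λ _ _ → z≤n

    length-shape : length shape ≡ y
    length-shape = length-map-upTo _ y

    rowLength-ℓ : ∀ r → r < y → rowLength x y T B (suc r) ≡ ℓ r
    rowLength-ℓ r r<y = trans (boolCount-upTo _ x) (∑-cong x λ p p<x → cong bit (begin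
      (nth (eastHeights B) p <ᵇ suc q) ∧ (q <ᵇ nth (eastHeights T) p)
        ≡⟨ cong₂ (λ b c → (b <ᵇ suc q) ∧ c) (nth≡ix (eastHeights B) p)
             (<ᵇ-yes (subst (q <_) (sym (trans (nth≡ix (eastHeights T) p) (ix-topPath x y p<x))) q<y)) ⟩
      (height B p <ᵇ suc q) ∧ _
        ≡⟨ ∧-identityʳ _ ⟩
      (height B p <ᵇ suc q)
        ≡⟨ cong (height B p <ᵇ_) suc-q ⟩
      (height B p <ᵇ (y ∸ r)) ∎))
      where
      open ≡-Reasoning
      q = y ∸ suc r
      suc-q : suc q ≡ y ∸ r
      suc-q = sym (+-∸-assoc 1 r<y)
      q<y : q < y
      q<y = subst (_≤ y) (sym suc-q) (m∸n≤m y r)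

    shape-ℓ : ∀ r → ix 0 shape r ≡ ℓ r
    shape-ℓ r with <-≤-connex r y
    ... | inj₁ r<y = trans (ix-map-upTo _ y r<y) (rowLength-ℓ r r<y)
    ... | inj₂ y≤r = trans (ix-beyond shape (subst (_≤ r) (sym length-shape) y≤r)) (sym (ℓ-end r y≤r))

    λ₁ = firstPart shape
    f = forced x y B

    -- The columns without a cell in the top row are those where `B` runs at height `y`, and these
    -- are its common east steps with `T`. Hence `λ₁ - (hᵢ - f)` is `x - hᵢ`, the row sum of jumps.
    λ₁+forced : λ₁ + f ≡ x
    λ₁+forced = begin
      λ₁ + f
        ≡⟨ cong₂ _+_ (trans (firstPart-ix shape) (shape-ℓ 0)) (coincide-∑ T B (topPath-to x y) toB) ⟩
      cnt x (height B) y + ∑ x (λ p → bit (height T p ≡ᵇ height B p))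
        ≡⟨ cong (λ z → cnt x (height B) y + z) (∑-cong x λ p p<x → cong (λ z → bit (z ≡ᵇ height B p)) (ix-topPath x y p<x)) ⟩
      cnt x (height B) y + ∑ x (λ p → bit (y ≡ᵇ height B p))
        ≡⟨ trans (∑-cong x λ p _ → lt-suc (height B p) y) (∑-distrib-+ x _ _) ⟨
      cnt x (height B) (suc y)
        ≡⟨ cnt-all x (height B) (suc y) (λ p p<x → s≤s (height-≤ B toB p p<x)) ⟩
      x ∎
      where
      open ≡-Reasoning
      firstPart-ix : ∀ λs → firstPart λs ≡ ix 0 λs 0
      firstPart-ix [] = refl
      firstPart-ix (_ ∷ _) = refl

    corrected : ℕ → ℤ
    corrected hᵢ = ℤ.+ λ₁ ℤ.- (ℤ.+ hᵢ ℤ.- ℤ.+ f)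

    corrected-injective : ∀ {a b} → corrected a ≡ corrected b → a ≡ b
    corrected-injective {a} {b} eq = ℤ.+-injective (trans (recover (ℤ.+ λ₁) (ℤ.+ a) (ℤ.+ f))
      (trans (cong (λ z → ℤ.+ λ₁ ℤ.- (z ℤ.- ℤ.+ f)) eq) (sym (recover (ℤ.+ λ₁) (ℤ.+ b) (ℤ.+ f)))))
      where
      recover : ∀ l i e → i ≡ l ℤ.- ((l ℤ.- (i ℤ.- e)) ℤ.- e)
      recover = ℤ.solve-∀

    corrected-complement : ∀ {c hᵢ} → c + hᵢ ≡ x → ℤ.+ c ≡ corrected hᵢ
    corrected-complement {c} {hᵢ} eq = begin
      ℤ.+ c ≡⟨ solve₁ (ℤ.+ c) (ℤ.+ hᵢ) ⟩
      (ℤ.+ c ℤ.+ ℤ.+ hᵢ) ℤ.- ℤ.+ hᵢ ≡⟨ cong (λ z → ℤ.+ z ℤ.- ℤ.+ hᵢ) (trans eq (sym λ₁+forced)) ⟩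
      (ℤ.+ λ₁ ℤ.+ ℤ.+ f) ℤ.- ℤ.+ hᵢ ≡⟨ solve₂ (ℤ.+ λ₁) (ℤ.+ f) (ℤ.+ hᵢ) ⟩
      corrected hᵢ ∎
      where
      open ≡-Reasoning
      solve₁ : ∀ c i → c ≡ (c ℤ.+ i) ℤ.- i
      solve₁ = ℤ.solve-∀
      solve₂ : ∀ l e i → (l ℤ.+ e) ℤ.- i ≡ l ℤ.- (i ℤ.- e)
      solve₂ = ℤ.solve-∀

    -- Symmetric in purpose: neither side is computed from the other. Existence and uniqueness are
    -- proved separately in each direction, which avoids composing the two algorithms.
    record Matches (Ps : Vec Path k) (t : Tableau) : Set where
      field
        diagram : ℕ → ℕ → ℕ → ℕ
        growth : Growth n y diagram
        bottomRows : ∀ j s → j ≤ n → s ≤ y → diagram j s 0 ≡ levels x y B Ps j s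
        edges : Edges n y diagram (atMost ℓ (entry t))

    open Matches

    levels-last : ∀ (Ps : Vec Path k) t → levels x y B Ps n t ≡ cnt x (height B) t
    levels-last Ps t = cong (λ P → cnt x (height P) t) (strand-last x y B Ps)

    path⇒tableau : ∀ {Ps} → System x y B Ps → ∃ λ t → IsFlagged k y ℓ t × Matches Ps t
    path⇒tableau {Ps} sys = tabulateRows y ℓ e ,
      tabulateRows-IsFlagged ℓ-end ℓ-antitone F , record
        { diagram = G
        ; growth = gr
        ; bottomRows = λ _ _ _ _ → refl
        ; edges = record { top = λ m m≤n r → trans (Edges.top ed m m≤n r) (same r m)
                         ; right = λ s s≤y i → trans (Edges.right ed s s≤y i) (same (s + i) (n + s)) } }
      where
      G = forward (levels x y B Ps)
      gr = system-growth x y B Ps sys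
      edge : ∀ r → G n (y ∸ r) 0 ≡ ℓ r
      edge r = levels-last Ps (y ∸ r)
      e = diagram-filling gr
      F = diagram-Filling gr edge ℓ-antitone
      ed = diagram-edges gr edge
      same : ∀ r m → atMost ℓ e r m ≡ atMost ℓ (entry (tabulateRows y ℓ e)) r m
      same r m = ∑-cong (ℓ r) λ p p<ℓ → cong (λ z → lt z (suc m))
        (sym (entry-tabulateRows ℓ-end e p<ℓ))

    tableau⇒path : ∀ {t} → IsFlagged k y ℓ t → ∃ λ Ps → System x y B Ps × Matches Ps t
    tableau⇒path {t} is = diagram-paths B toB gr edge , diagram-system B toB gr edge , record
      { diagram = G ; growth = gr ; bottomRows = diagram-levels B toB gr edge ; edges = ed }
      where
      open IsFlagged is
      G = filling-diagram ℓ-antitone ℓ-end filling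
      gr = filling-growth ℓ-antitone ℓ-end filling
      ed = filling-edges ℓ-antitone ℓ-end filling
      -- The first part on the right edge counts a row that the flag makes full, so it is a row
      -- length, and row lengths are the counting function of `B`.
      edge : ∀ s → s ≤ y → G n s 0 ≡ cnt x (height B) s
      edge s s≤y = begin
        G n s 0 ≡⟨ cong (λ z → G n z 0) (m∸[m∸n]≡n s≤y) ⟨
        G n (y ∸ (y ∸ s)) 0 ≡⟨ Edges.right ed (y ∸ s) (m∸n≤m y s) 0 ⟩
        atMost ℓ (entry t) (y ∸ s + 0) (n + (y ∸ s))
          ≡⟨ atMost-flag ℓ-antitone ℓ-end filling (≤-reflexive (cong (λ z → n + z) (+-identityʳ (y ∸ s)))) ⟩
        ℓ (y ∸ s + 0) ≡⟨ cong ℓ (+-identityʳ (y ∸ s)) ⟩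
        ℓ (y ∸ s) ≡⟨ cong (cnt x (height B)) (m∸[m∸n]≡n s≤y) ⟩
        cnt x (height B) s ∎
        where open ≡-Reasoning

    matches-path-unique : ∀ {Ps Qs t} → System x y B Ps → System x y B Qs →
      Matches Ps t → Matches Qs t → Ps ≡ Qs
    matches-path-unique sysP sysQ M M' = System-unique sysP sysQ λ j s j≤n s≤y →
      trans (sym (bottomRows M j s j≤n s≤y)) (trans
        (growth-uniqueᵇ (growth M) (growth M')
          (λ m m≤n r → trans (Edges.top (edges M) m m≤n r) (sym (Edges.top (edges M') m m≤n r)))
          (λ s s≤y i → trans (right-at (edges M) s s≤y i) (sym (right-at (edges M') s s≤y i)))
          j s 0 j≤n s≤y)
        (bottomRows M' j s j≤n s≤y))
      where
      right-at : ∀ {G C} → Edges n y G C → ∀ s → s ≤ y → ∀ i → G n s i ≡ C (y ∸ s + i) (n + (y ∸ s))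
      right-at {G} {C} ed s s≤y i = trans (cong (λ z → G n z i) (sym (m∸[m∸n]≡n s≤y))) (Edges.right ed (y ∸ s) (m∸n≤m y s) i)

    matches-tableau-unique : ∀ {Ps t t'} → IsFlagged k y ℓ t → IsFlagged k y ℓ t' →
      Matches Ps t → Matches Ps t' → t ≡ t'
    matches-tableau-unique {t = t} {t'} is is' M M' = IsFlagged-unique is is' same
      where
      G≡G' = growth-unique (growth M) (growth M') λ j s j≤n s≤y →
        trans (bottomRows M j s j≤n s≤y) (sym (bottomRows M' j s j≤n s≤y))
      high : ∀ s i → s + i < y → atMost ℓ (entry t) (s + i) (n + s) ≡ atMost ℓ (entry t') (s + i) (n + s)
      high s i s+i<y = trans (sym (Edges.right (edges M) s s≤y i))
        (trans (G≡G' n (y ∸ s) i ≤-refl (m∸n≤m y s)) (Edges.right (edges M') s s≤y i))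
        where s≤y = ≤-trans (m≤m+n s i) (<⇒≤ s+i<y)
      same : ∀ r → r < y → ∀ m → m ≤ n + r → atMost ℓ (entry t) r m ≡ atMost ℓ (entry t') r m
      same r r<y m m≤n+r with ≤-total m n
      ... | inj₁ m≤n = trans (sym (Edges.top (edges M) m m≤n r))
              (trans (G≡G' m y r m≤n ≤-refl) (Edges.top (edges M') m m≤n r))
      -- Here `m = n + s`, and the flag bound on `m` gives `s ≤ r`, so the count is a part on the
      -- right edge at height `y ∸ s`.
      ... | inj₂ n≤m = subst₂ (λ r m → atMost ℓ (entry t) r m ≡ atMost ℓ (entry t') r m)
              (m+[n∸m]≡n s≤r) (m+[n∸m]≡n n≤m) (high (m ∸ n) (r ∸ (m ∸ n)) (subst (_< y) (sym (m+[n∸m]≡n s≤r)) r<y))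
        where
        s≤r : m ∸ n ≤ r
        s≤r = m≤n+o⇒m∸n≤o m n m≤n+r

    statistics : Vec Path k → List ℤ
    statistics Ps = map corrected (hVec T B Ps) ++ map ℤ.+_ (uVec x y T B Ps)

    length-hVec : ∀ Ps → length (hVec T B Ps) ≡ n
    length-hVec Ps = trans (length-consecCoincide T (toList Ps ++ B ∷ [])) (length-line x y B Ps)

    length-uVec : ∀ (Ps : Vec Path k) → length (uVec x y T B Ps) ≡ y ∸ 1
    length-uVec Ps = trans (length-map _ (map suc (upTo (y ∸ 1)))) (length-map-upTo suc (y ∸ 1))

    length-++-map : ∀ {X Y : Set} (g : X → ℤ) (g' : Y → ℤ) us vs {a b} → length us ≡ a → length vs ≡ b →
      length (map g us ++ map g' vs) ≡ a + b
    length-++-map g g' us vs lu lv = trans (length-++ (map g us))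
      (cong₂ _+_ (trans (length-map g us) lu) (trans (length-map g' vs) lv))

    weights : ∀ {Ps t} → System x y B Ps → IsFlagged k y ℓ t → Matches Ps t →
      map (λ i → ℤ.+ countEntry (suc i) t) (upTo (n + (y ∸ 1))) ≡ statistics Ps
    weights {Ps} {t} sys is M = ix-ext {d = ℤ.+ 0} _ _
      (trans (length-map-upTo _ (n + (y ∸ 1))) (sym (length-++-map corrected ℤ.+_ hs us (length-hVec Ps) (length-uVec Ps))))
      λ i i< → let i<N = subst (i <_) (length-map-upTo _ (n + (y ∸ 1))) i< in
        trans (ix-map-upTo _ (n + (y ∸ 1)) i<N) (at i i<N)
      where
      open IsFlagged is
      hs = hVec T B Ps
      us = uVec x y T B Ps

      low : ∀ j → j < n → ℤ.+ countEntry (suc j) t ≡ ix (ℤ.+ 0) (statistics Ps) j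
      low j j<n = begin
        ℤ.+ countEntry (suc j) t
          ≡⟨ corrected-complement (trans
               (cong₂ _+_ (trans (countEntry≡entries (suc j)) (entries-low filling (growth M) (edges M) j j<n))
                          (ix-consecCoincide T (toList Ps ++ B ∷ []) j (subst (j <_) (sym (length-line x y B Ps)) j<n)))
               (jumps+coincide x y B Ps sys (growth M) (bottomRows M) j j<n)) ⟩
        corrected (ix 0 hs j)
          ≡⟨ ix-map-in corrected hs (subst (j <_) (sym (length-hVec Ps)) j<n) ⟨
        ix (ℤ.+ 0) (map corrected hs) j
          ≡⟨ ix-++ˡ (map corrected hs) _ (subst (j <_) (sym (trans (length-map corrected hs) (length-hVec Ps))) j<n) ⟨
        ix (ℤ.+ 0) (statistics Ps) j ∎
        where
        open ≡-Reasoning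
        ix-map-in : ∀ (g : ℕ → ℤ) xs {p} → p < length xs → ix (ℤ.+ 0) (map g xs) p ≡ g (ix 0 xs p)
        ix-map-in g (x ∷ xs) {zero} _ = refl
        ix-map-in g (x ∷ xs) {suc p} (s≤s p<) = ix-map-in g xs p<

      high : ∀ s → s < y ∸ 1 → ℤ.+ countEntry (suc (n + s)) t ≡ ix (ℤ.+ 0) (statistics Ps) (n + s)
      high s s<y∸1 = begin
        ℤ.+ countEntry (suc (n + s)) t
          ≡⟨ cong ℤ.+_ (+-cancelʳ-≡ jumps _ _ (trans
               (cong (_+ jumps) (countEntry≡entries (suc (n + s))))
               (trans (entries-high filling (growth M) (edges M) s s<y) (sym (trans
                 (unused+jumps x y B Ps sys (growth M) (bottomRows M) (y ∸ suc s) below)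
                 (trans (levels-last Ps (suc (y ∸ suc s))) (cong (cnt x (height B)) (sym (+-∸-assoc 1 s<y))))))))) ⟩
        ℤ.+ unusedAt x T B (toList Ps) (y ∸ suc s)
          ≡⟨ cong ℤ.+_ (trans (cong (λ us → ix 0 us s) (sym (map-∘ (upTo (y ∸ 1))))) (ix-map-upTo _ (y ∸ 1) s<y∸1)) ⟨
        ℤ.+ ix 0 us s
          ≡⟨ ix-map {d = 0} ℤ.+_ us s ⟨
        ix (ℤ.+ 0) (map ℤ.+_ us) s
          ≡⟨ ix-++ʳ (map corrected hs) (map ℤ.+_ us) s ⟨
        ix (ℤ.+ 0) (statistics Ps) (length (map corrected hs) + s)
          ≡⟨ cong (λ z → ix (ℤ.+ 0) (statistics Ps) (z + s)) (trans (length-map corrected hs) (length-hVec Ps)) ⟩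
        ix (ℤ.+ 0) (statistics Ps) (n + s) ∎
        where
        open ≡-Reasoning
        jumps = ∑ n (λ j → jump (growth M) j (y ∸ suc s))
        s<y : s < y
        s<y = ≤-trans s<y∸1 (m∸n≤m y 1)
        below : y ∸ suc s < y
        below = subst (_≤ y) (+-∸-assoc 1 s<y) (m∸n≤m y s)

      at : ∀ i → i < n + (y ∸ 1) → ℤ.+ countEntry (suc i) t ≡ ix (ℤ.+ 0) (statistics Ps) i
      at i i<N with <-≤-connex i n
      ... | inj₁ i<n = low i i<n
      ... | inj₂ n≤i = subst (λ i → ℤ.+ countEntry (suc i) t ≡ ix (ℤ.+ 0) (statistics Ps) i) (m+[n∸m]≡n n≤i)
              (high (i ∸ n) (+-cancelˡ-< n _ _ (subst (_< n + (y ∸ 1)) (sym (m+[n∸m]≡n n≤i)) i<N)))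

  module _ (1≤k : 1 ≤ k) (h : Vec ℕ (suc k)) (u : Vec ℕ (y ∸ 1)) where
    private
      target = targetWeight k x y B h u

      length-target : length target ≡ n + (y ∸ 1)
      length-target = length-++-map corrected ℤ.+_ (toList h) (toList u) (length-toList h) (length-toList u)

      weight⇒ : ∀ {Ps t} → System x y B Ps → IsFlagged k y ℓ t → Matches Ps t →
        hVec T B Ps ≡ toList h → uVec x y T B Ps ≡ toList u → HasWeight target t
      weight⇒ {Ps} {t} sys is M hs us =
        trans (cong (λ z → map (λ i → ℤ.+ countEntry (suc i) t) (upTo z)) length-target)
          (trans (weights sys is M) (cong₂ (λ hs us → map corrected hs ++ map ℤ.+_ us) hs us)) ,
        IsFlagged.bounded is (subst (k + y ≤_) (sym length-target)
          (≤-trans (+-monoʳ-≤ k (m≤n+m∸n y 1)) (≤-reflexive (+-suc k (y ∸ 1)))))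

      weight⇐ : ∀ {Ps t} → System x y B Ps → IsFlagged k y ℓ t → Matches Ps t →
        HasWeight target t → hVec T B Ps ≡ toList h × uVec x y T B Ps ≡ toList u
      weight⇐ {Ps} {t} sys is M (weight , _) =
        map-injective corrected-injective (proj₁ halves) , map-injective ℤ.+-injective (proj₂ halves)
        where
        halves = ++-injective
          (trans (trans (length-map corrected (hVec T B Ps)) (length-hVec Ps))
                 (sym (trans (length-map corrected (toList h)) (length-toList h))))
          (trans (sym (weights sys is M))
            (trans (cong (λ z → map (λ i → ℤ.+ countEntry (suc i) t) (upTo z)) (sym length-target)) weight))

      tuple-system : (P : PathTuples k x y B h u) → System x y B (proj₁ P)
      tuple-system (Ps , inPk , _) = InPk⇒System x y B Ps 1≤k toB inPk

      tableau-flagged : (t : FlaggedTableaux k x y B h u) → IsFlagged k y ℓ (proj₁ t)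
      tableau-flagged (t , ssyt , flagged , _) = SSYT⇒IsFlagged shape length-shape shape-ℓ ssyt flagged

      abstract
        -- The evidence of `Matches` travels with the tableau; it is all that injectivity and
        -- surjectivity use of the construction.
        Ψ : (P : PathTuples k x y B h u) → Σ (FlaggedTableaux k x y B h u) λ t → Matches (proj₁ P) (proj₁ t)
        Ψ P@(Ps , inPk , hs , us) with path⇒tableau (tuple-system P)
        ... | t , is , M with IsFlagged⇒SSYT shape length-shape shape-ℓ ℓ-antitone is
        ... | ssyt , flagged = (t , ssyt , flagged , weight⇒ (tuple-system P) is M hs us) , M

      tuple-≡ : {P Q : PathTuples k x y B h u} → proj₁ P ≡ proj₁ Q → P ≡ Q
      tuple-≡ {_ , p} {_ , q} refl = cong (_ ,_)
        (×-irrelevant (InPk-irrelevant {T = T} {B}) (×-irrelevant ≡-irrelevant ≡-irrelevant) p q)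

      tableau-≡ : {t t' : FlaggedTableaux k x y B h u} → proj₁ t ≡ proj₁ t' → t ≡ t'
      tableau-≡ {t , p} {_ , q} refl = cong (_ ,_)
        (×-irrelevant IsSSYT-irrelevant (×-irrelevant (FlaggedFrom-irrelevant t) (HasWeight-irrelevant {target})) p q)

      injective : ∀ {P Q} → proj₁ (Ψ P) ≡ proj₁ (Ψ Q) → P ≡ Q
      injective {P} {Q} eq = tuple-≡ {P} {Q} (matches-path-unique (tuple-system P) (tuple-system Q)
        (subst (Matches (proj₁ P) ∘ proj₁) eq (proj₂ (Ψ P))) (proj₂ (Ψ Q)))

      -- The image of the tuple obtained from `t` matches that tuple, as `t` does, so uniqueness of
      -- the tableau identifies the two.
      surjective : ∀ t → ∃ λ P → proj₁ (Ψ P) ≡ t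
      surjective t with tableau⇒path (tableau-flagged t)
      ... | Ps , sys , M = P , tableau-≡ {proj₁ (Ψ P)} {t} (matches-tableau-unique (tableau-flagged (proj₁ (Ψ P))) (tableau-flagged t) (proj₂ (Ψ P)) M)
        where
        P : PathTuples k x y B h u
        P = Ps , System⇒InPk x y B Ps sys , weight⇐ sys (tableau-flagged t) M (proj₂ (proj₂ (proj₂ t)))

    bijection : PathTuples k x y B h u ⤖ FlaggedTableaux k x y B h u
    bijection = mk⤖ {to = proj₁ ∘ Ψ} (injective , strictlySurjective⇒surjective surjective)

theorem7p1 : (k x y : ℕ) → 1 ≤ k →
    (B : Path) → PathTo x y B →
    (h : Vec ℕ (suc k)) → (u : Vec ℕ (y ∸ 1)) →
    PathTuples k x y B h u ⤖ FlaggedTableaux k x y B h u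
theorem7p1 k x y 1≤k B toB h u = bijection k x y B toB 1≤k h u
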